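{- There is an algorithm that, given any instance $(G,\pi,S)$ of the problem Balanced Vertex where $G$ is a graph with $n$ vertices and $m$ edges, solves it in ${\cal O}(nm)$ time.
   Context: All graphs are finite, simple, connected, with unit-length edges; $n=|V|$, $m=|E|$, and $d(u,v)$ is the shortest-path distance. A proper vertex list is a list $S=(s_1,\ldots,s_p)$ of pairwise different vertices; $d(v,S)=\min_i d(v,s_i)$. The (prioritized) Voronoi diagram of $G=(V,E)$ with respect to $S$ is the partition of $V$ into territories $\mathbb{T}(s_1,S),\ldots,\mathbb{T}(s_p,S)$ where $v\in\mathbb{T}(s_i,S)$ if and only if $d(v,s_i)=d(v,S)$ and $d(v,s_j)>d(v,S)$ for every $j$ with $1\le j<i$. For a cost function $\pi:V\to\mathbb{R}_{\ge 0}$, the load of $s_i$ is $\ell_\pi(s_i,S)=\sum_{v\in\mathbb{T}(s_i,S)}\pi(v)$, and $L_\pi(S)=\max_i \ell_\pi(s_i,S)$. For $v\in V\setminus S$, $S+v=(s_1,\ldots,s_p,v)$. Balanced Vertex: given a graph $G=(V,E)$, a cost function $\pi:V\to\mathbb{R}_{\ge 0}$ and a proper vertex list $S$, output a vertex $v\in V\setminus S$ such that $L_\pi(S+v)$ is minimized. Running times are worst-case, in the usual unit-cost RAM model. -}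

module Defs where

open import Level using (Level; 0ℓ; _⊔_) renaming (suc to lsuc)
open import Algebra.Bundles using (CommutativeRing)
open import Algebra.Structures using (IsCommutativeRing)
open import Data.Bool.Base using (if_then_else_)
open import Data.Fin.Base as Fin using (Fin; toℕ)
import Data.Fin.Properties as Fin
open import Data.List.Base as List using (List; []; _∷_; _++_)
import Data.List.Membership.Propositional as List
open import Data.List.Relation.Unary.Unique.Propositional renaming (Unique to UniqueList)
open import Data.Maybe.Base using (Maybe; just; nothing)
open import Data.Nat.Base as ℕ using (ℕ; zero; suc; s≤s)
import Data.Nat.Properties as ℕ
open import Data.Product.Base using (∃; _×_; _,_; proj₁; proj₂)
open import Data.Vec.Base as Vec using (Vec; _∷ʳ_; lookup)
open import Data.Vec.Membership.Propositional using (_∉_)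
open import Data.Vec.Relation.Unary.Unique.Propositional using (Unique)
open import Function.Base using (_∘_)
open import Function.Bundles using (_⇔_)
open import Relation.Binary.Bundles using (DecTotalOrder)
open import Relation.Binary.Core using (Rel)
import Relation.Binary.Definitions as Rel
open import Relation.Binary.PropositionalEquality.Core using (_≡_)
open import Relation.Binary.Structures using (IsDecTotalOrder)
open import Relation.Nullary.Decidable using (Dec; does; yes; no; _×-dec_; _→-dec_)
open import Relation.Nullary.Negation using (¬_)
open import Relation.Unary using (Pred; Decidable)
import Algebra.Construct.NaturalChoice.Max as Max
import Algebra.Properties.CommutativeMonoid.Sum as Sum

-- The costs live in an arbitrary totally ordered field, of which ℝ is an
-- instance.  (There is no type of classical reals in the library; only the
-- decidability of ≤, which a real RAM has as a primitive, goes beyond the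
-- usual axioms.)

record OrderedField c ℓ₁ ℓ₂ : Set (lsuc (c ⊔ ℓ₁ ⊔ ℓ₂)) where
  infix  8 -_
  infixl 7 _*_
  infixl 6 _+_ _-_
  infix  4 _≈_ _≤_
  field
    Carrier           : Set c
    _≈_               : Rel Carrier ℓ₁
    _≤_               : Rel Carrier ℓ₂
    _+_ _*_           : Carrier → Carrier → Carrier
    -_                : Carrier → Carrier
    0# 1#             : Carrier
    isCommutativeRing : IsCommutativeRing _≈_ _+_ _*_ -_ 0# 1#
    isDecTotalOrder   : IsDecTotalOrder _≈_ _≤_
    0≉1               : ¬ (0# ≈ 1#)
    inverse           : ∀ x → ¬ (x ≈ 0#) → ∃ λ y → x * y ≈ 1#
    +-monoˡ-≤         : ∀ z {x y} → x ≤ y → x + z ≤ y + z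
    *-nonNeg          : ∀ {x y} → 0# ≤ x → 0# ≤ y → 0# ≤ x * y

  _-_ : Carrier → Carrier → Carrier
  x - y = x + - y

  commutativeRing : CommutativeRing c ℓ₁
  commutativeRing = record { isCommutativeRing = isCommutativeRing }

  decTotalOrder : DecTotalOrder c ℓ₁ ℓ₂
  decTotalOrder = record { isDecTotalOrder = isDecTotalOrder }

  open DecTotalOrder decTotalOrder public using (_≤?_; totalOrder)
  open CommutativeRing commutativeRing public using (+-commutativeMonoid)

------------------------------------------------------------------------
-- Graphs and distances

Walk : ∀ {n} → Rel (Fin n) 0ℓ → ℕ → Rel (Fin n) 0ℓ
Walk Adj zero    u v = u ≡ v
Walk Adj (suc k) u v = ∃ λ w → Adj u w × Walk Adj k w v

record Graph (n : ℕ) : Set₁ where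
  field
    Adj       : Rel (Fin n) 0ℓ
    adj?      : Rel.Decidable Adj
    symmetric : ∀ {u v} → Adj u v → Adj v u
    loopless  : ∀ {v} → ¬ Adj v v
    connected : ∀ u v → ∃ λ k → Walk Adj k u v

  size : ℕ
  size = List.length (List.filter (λ e → (proj₁ e Fin.<? proj₂ e) ×-dec adj? (proj₁ e) (proj₂ e))
                                  (List.cartesianProduct (List.allFin n) (List.allFin n)))

least : ∀ {p} {P : Pred ℕ p} → Decidable P → ∀ k → P k →
        ∃ λ d → P d × (∀ {j} → j ℕ.< d → ¬ P j)
least P? zero    pk = 0 , pk , λ ()
least P? (suc k) pk with P? 0
... | yes p0 = 0 , p0 , λ ()
... | no ¬p0 with least (P? ∘ suc) k pk
...   | d , pd , min = suc d , pd , λ { {zero} _ → ¬p0 ; {suc j} (s≤s j<d) → min j<d }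

module _ {n} (G : Graph n) where
  open Graph G

  walk? : ∀ k u v → Dec (Walk Adj k u v)
  walk? zero    u v = u Fin.≟ v
  walk? (suc k) u v = Fin.any? λ w → adj? u w ×-dec walk? k w v

  -- A walk of minimum length is a path, so this is the shortest-path distance.
  dist : Fin n → Fin n → ℕ
  dist u v = proj₁ (least (λ k → walk? k u v) (proj₁ (connected u v)) (proj₂ (connected u v)))

  distTo : ∀ {q} → Fin n → Vec (Fin n) (suc q) → ℕ
  distTo v S = Vec.foldr₁ ℕ._⊓_ (Vec.map (dist v) S)

  InTerritory : ∀ {q} → Vec (Fin n) (suc q) → Fin (suc q) → Fin n → Set
  InTerritory S i v = dist v (lookup S i) ≡ distTo v S
                    × (∀ j → j Fin.< i → distTo v S ℕ.< dist v (lookup S j))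

  inTerritory? : ∀ {q} (S : Vec (Fin n) (suc q)) i v → Dec (InTerritory S i v)
  inTerritory? S i v = (dist v (lookup S i) ℕ.≟ distTo v S)
    ×-dec Fin.all? λ j → (j Fin.<? i) →-dec (distTo v S ℕ.<? dist v (lookup S j))

------------------------------------------------------------------------
-- Balanced Vertex

module _ {c ℓ₁ ℓ₂} (R : OrderedField c ℓ₁ ℓ₂) where
  open OrderedField R
  open Sum +-commutativeMonoid using (sum)

  load : ∀ {n q} → Graph n → (Fin n → Carrier) → Vec (Fin n) (suc q) → Fin (suc q) → Carrier
  load G π S i = sum λ v → if does (inTerritory? G S i v) then π v else 0#

  maxLoad : ∀ {n q} → Graph n → (Fin n → Carrier) → Vec (Fin n) (suc q) → Carrier
  maxLoad G π S = Vec.foldr₁ (Max._⊔_ totalOrder) (Vec.tabulate (load G π S))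

  record Instance : Set (lsuc 0ℓ ⊔ c ⊔ ℓ₂) where
    field
      {n}        : ℕ
      graph      : Graph n
      π          : Fin n → Carrier
      π-nonNeg   : ∀ v → 0# ≤ π v
      {q}        : ℕ
      S          : Vec (Fin n) (suc q)
      proper     : Unique S
      -- V ∖ S is nonempty; otherwise no output exists.
      candidate  : ∃ λ v → v ∉ S

    m : ℕ
    m = Graph.size graph

  IsSolution : (I : Instance) → Fin (Instance.n I) → Set ℓ₂
  IsSolution I v = v ∉ S × (∀ w → w ∉ S → maxLoad graph π (S ∷ʳ v) ≤ maxLoad graph π (S ∷ʳ w))
    where open Instance I

------------------------------------------------------------------------
-- The unit-cost RAM

-- A random access machine in the style of Cook and Reckhow: memory cells X₀, X₁, …
-- holding natural numbers, and two input tapes.  As costs are reals there is a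
-- second bank of cells Y₀, Y₁, … holding field elements, which can be moved,
-- added, subtracted and compared, but not converted to natural numbers.
-- There is no multiplication, so large numbers cannot be built up by
-- repeated squaring at unit cost.

data Instr : Set where
  const   : (i k : ℕ) → Instr       -- Xᵢ ← k
  add sub : (i j k : ℕ) → Instr     -- Xᵢ ← Xⱼ + Xₖ,  Xᵢ ← Xⱼ ∸ Xₖ
  loadᴺ   : (i j : ℕ) → Instr       -- Xᵢ ← X_(Xⱼ)
  storeᴺ  : (i j : ℕ) → Instr       -- X_(Xᵢ) ← Xⱼ
  read    : (i : ℕ) → Instr         -- Xᵢ ← next natural number of the input
  goto    : (l : ℕ) → Instr
  ifPos   : (i l : ℕ) → Instr       -- goto l if Xᵢ > 0
  zeroᴿ   : (i : ℕ) → Instr         -- Yᵢ ← 0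
  addᴿ subᴿ : (i j k : ℕ) → Instr   -- Yᵢ ← Yⱼ + Yₖ,  Yᵢ ← Yⱼ - Yₖ
  loadᴿ   : (i j : ℕ) → Instr       -- Yᵢ ← Y_(Xⱼ)
  storeᴿ  : (i j : ℕ) → Instr       -- Y_(Xᵢ) ← Yⱼ
  readᴿ   : (i : ℕ) → Instr         -- Yᵢ ← next field element of the input
  ifLeqᴿ  : (i j l : ℕ) → Instr     -- goto l if Yᵢ ≤ Yⱼ

Program : Set
Program = List Instr

fetch : Program → ℕ → Maybe Instr
fetch P l = List.head (List.drop l P)

_[_↦_] : ∀ {a} {A : Set a} → (ℕ → A) → ℕ → A → (ℕ → A)
(f [ i ↦ x ]) j = if does (j ℕ.≟ i) then x else f j

module RAM {c ℓ₁ ℓ₂} (R : OrderedField c ℓ₁ ℓ₂) where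
  open OrderedField R

  record Config : Set c where
    constructor config
    field
      pc    : ℕ
      X     : ℕ → ℕ
      Y     : ℕ → Carrier
      tape  : List ℕ
      tapeᴿ : List Carrier

  open Config

  -- Reading past the end of a tape yields zero.
  next : ∀ {a} {A : Set a} → A → List A → A × List A
  next z []       = z , []
  next z (x ∷ xs) = x , xs

  exec : Instr → Config → Config
  exec (const i k)    (config l X Y t r) = config (suc l) (X [ i ↦ k ]) Y t r
  exec (add i j k)    (config l X Y t r) = config (suc l) (X [ i ↦ X j ℕ.+ X k ]) Y t r
  exec (sub i j k)    (config l X Y t r) = config (suc l) (X [ i ↦ X j ℕ.∸ X k ]) Y t r
  exec (loadᴺ i j)    (config l X Y t r) = config (suc l) (X [ i ↦ X (X j) ]) Y t r
  exec (storeᴺ i j)   (config l X Y t r) = config (suc l) (X [ X i ↦ X j ]) Y t r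
  exec (read i)       (config l X Y t r) =
    config (suc l) (X [ i ↦ proj₁ (next 0 t) ]) Y (proj₂ (next 0 t)) r
  exec (goto l′)      (config l X Y t r) = config l′ X Y t r
  exec (ifPos i l′)   (config l X Y t r) =
    config (if does (0 ℕ.<? X i) then l′ else suc l) X Y t r
  exec (zeroᴿ i)      (config l X Y t r) = config (suc l) X (Y [ i ↦ 0# ]) t r
  exec (addᴿ i j k)   (config l X Y t r) = config (suc l) X (Y [ i ↦ Y j + Y k ]) t r
  exec (subᴿ i j k)   (config l X Y t r) = config (suc l) X (Y [ i ↦ Y j - Y k ]) t r
  exec (loadᴿ i j)    (config l X Y t r) = config (suc l) X (Y [ i ↦ Y (X j) ]) t r
  exec (storeᴿ i j)   (config l X Y t r) = config (suc l) X (Y [ X i ↦ Y j ]) t r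
  exec (readᴿ i)      (config l X Y t r) =
    config (suc l) X (Y [ i ↦ proj₁ (next 0# r) ]) t (proj₂ (next 0# r))
  exec (ifLeqᴿ i j l′) (config l X Y t r) =
    config (if does (Y i ≤? Y j) then l′ else suc l) X Y t r

  -- P ⊢ s ⇓[ t ] s′ : started in s, P halts in s′ after exactly t instructions.
  -- A program halts when the program counter leaves it.
  infix 4 _⊢_⇓[_]_
  data _⊢_⇓[_]_ (P : Program) : Config → ℕ → Config → Set c where
    halt : ∀ {s} → fetch P (pc s) ≡ nothing → P ⊢ s ⇓[ 0 ] s
    step : ∀ {s s′ t ι} → fetch P (pc s) ≡ just ι →
           P ⊢ exec ι s ⇓[ t ] s′ → P ⊢ s ⇓[ suc t ] s′

  start : List ℕ → List Carrier → Config
  start = config 0 (λ _ → 0) (λ _ → 0#)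

  -- The output is the final content of X₀.
  output : Config → ℕ
  output s = X s 0

------------------------------------------------------------------------
-- Input format

record AdjacencyLists {n} (G : Graph n) : Set where
  field
    nbrs     : Fin n → List (Fin n)
    unique   : ∀ v → UniqueList (nbrs v)
    complete : ∀ u v → u List.∈ nbrs v ⇔ Graph.Adj G v u

module _ {c ℓ₁ ℓ₂} (R : OrderedField c ℓ₁ ℓ₂) (I : Instance R) where
  open Instance I
  open RAM R

  -- First tape: n, |S|, the members of S in order, and for each vertex its
  -- degree followed by its neighbours.  Second tape: the costs.
  input : AdjacencyLists graph → Config
  input A = start
    (n ∷ suc q ∷ List.map toℕ (Vec.toList S)
      ++ List.concatMap (λ v → List.length (nbrs v) ∷ List.map toℕ (nbrs v)) (List.allFin n))
    (List.tabulate π)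
    where open AdjacencyLists A

{-# OPTIONS --safe #-}
{-
A breadth-first search from each member of S gives every vertex u its distance
to S and its owner.  Since a new site w comes last in the list, it takes over
exactly the vertices that are strictly closer to w than to S, so one search
from w followed by a pass over the vertices yields all loads for S + w.  Every
search or pass takes O(n + m) steps and there are at most 2n of them; finally
n ≤ Σ deg = 2m, as G is connected and has at least two vertices.

As G is connected, a search serves exactly n queue entries, so counted loops
suffice.  Programs are therefore written in a small language with arrays and
counted loops, whose semantics and cost are total functions, and are translated
to the RAM with constant overhead.
-}
module Submission where

open import Defs
import Level
open import Algebra.Bundles using (CommutativeMonoid)
import Algebra.Construct.NaturalChoice.Max as Max
import Algebra.Properties.CommutativeMonoid.Sum as Sum
open import Data.Bool.Base using (Bool; true; false; if_then_else_; T; not)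
open import Data.Fin.Base as Fin using (Fin; zero; suc; toℕ; fromℕ; fromℕ<; inject₁; punchIn)
import Data.Fin.Properties as Fin
open import Data.Fin.Relation.Unary.Top using (view; ‵fromℕ; ‵inject₁)
open import Data.List.Base as List using (List; []; _∷_; _++_; length)
import Data.List.Membership.Propositional as List
import Data.List.Membership.Propositional.Properties as List
import Data.List.Properties as List
import Data.List.Relation.Unary.All as All
import Data.List.Relation.Unary.All.Properties as All
import Data.List.Relation.Unary.AllPairs as AllPairs
import Data.List.Relation.Unary.AllPairs.Properties as AllPairs
import Data.List.Relation.Unary.Any as Any
import Data.List.Relation.Unary.Any.Properties as Any
open import Data.List.Relation.Unary.Unique.Propositional renaming (Unique to UniqueList)
import Data.List.Relation.Unary.Unique.Propositional.Properties as Unique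
open import Data.Maybe.Base using (Maybe; just; nothing)
open import Data.Nat.Base
open import Data.Nat.Properties
open import Data.Nat.Tactic.RingSolver using (solve-∀)
open import Data.Product.Base using (Σ; ∃; ∃₂; _×_; _,_; proj₁; proj₂)
open import Data.Sum.Base using (_⊎_; inj₁; inj₂)
open import Data.Unit.Base using (⊤; tt)
open import Data.Vec.Base as Vec using (Vec; []; _∷_; _∷ʳ_; lookup)
open import Data.Vec.Membership.Propositional using () renaming (_∈_ to _∈ᵛ_; _∉_ to _∉ᵛ_)
open import Data.Vec.Membership.Propositional.Properties using (∈-lookup)
import Data.Vec.Relation.Unary.Any as VecAny
import Data.Vec.Relation.Unary.Any.Properties as VecAny
open import Data.Vec.Relation.Unary.Unique.Propositional.Properties using (lookup-injective)
open import Function.Base using (_∘_)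
open import Function.Bundles using (mk⇔; module Equivalence)
import Relation.Binary.Bundles as Bundles
open import Relation.Binary.Definitions using (tri<; tri≈; tri>)
open import Relation.Binary.PropositionalEquality hiding (setoid)
open import Relation.Nullary.Decidable using (Dec; does; does-⇔; yes; no; _×-dec_)
open import Relation.Nullary.Negation using (¬_; contradiction)

-- The obstacle is the inner loop of a search. It makes as many rounds as the served vertex has
-- neighbours, so a fixed price per outer round would only give n times the maximum degree. The loop
-- rule `repeat-credit` therefore carries a credit through the rounds, and the search pays from a
-- potential that contains the degrees of all unserved vertices. Most other loops use the special
-- case of a fixed price per round. Counters run downwards. The sites are thus compared from last to
-- first, and the priority order of the list is obtained by letting the newcomer win ties. Distances
-- are stored increased by one. This frees zero as the mark of an unvisited vertex and of a vertex
-- without an owner, and it agrees with the initial contents of memory.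

module _ {a} {A : Set a} where

  update-same : ∀ (f : ℕ → A) i x → (f [ i ↦ x ]) i ≡ x
  update-same f i x with i ≡ᵇ i | ≡⇒≡ᵇ i i refl
  ... | true | _ = refl

  update-other : ∀ (f : ℕ → A) {i j} x → j ≢ i → (f [ i ↦ x ]) j ≡ f j
  update-other f {i} {j} x j≢i with j ≡ᵇ i | ≡ᵇ⇒≡ j i
  ... | true  | j≡i = contradiction (j≡i tt) j≢i
  ... | false | _   = refl

-- A structured language with arrays whose only loops are counted ones, so
-- that both its semantics and its running time are total functions.

infixr 4 _⨾_

data Op : Set where
  set           : (i k : ℕ) → Op
  mov movF      : (i j : ℕ) → Op
  inc           : (i : ℕ) → Op
  plus minus    : (i j k : ℕ) → Op
  get getF      : (i a j : ℕ) → Op      -- vᵢ ← a[vⱼ]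
  put putF      : (a i j : ℕ) → Op      -- a[vᵢ] ← vⱼ
  readN readF   : (i : ℕ) → Op
  zeroF         : (i : ℕ) → Op
  plusF         : (i j k : ℕ) → Op

data Cmd : Set where
  skip       : Cmd
  op         : Op → Cmd
  _⨾_        : Cmd → Cmd → Cmd
  ifPositive : (i : ℕ) → Cmd → Cmd → Cmd
  ifLeqF     : (i j : ℕ) → Cmd → Cmd → Cmd
  -- The body runs with vᵢ = k-1, …, 1, 0, where k is the value of vᵢ on entry.
  loop       : (i : ℕ) → Cmd → Cmd

-- The second predicate is about loop counters, which a loop overwrites without any `Op`. On a
-- concrete command the instances below reduce to products of unit types, so that `_` proves them.
Every : (Op → Set) → (ℕ → Set) → Cmd → Set
Every P Q skip               = ⊤
Every P Q (op o)             = P o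
Every P Q (C ⨾ D)            = Every P Q C × Every P Q D
Every P Q (ifPositive _ C D) = Every P Q C × Every P Q D
Every P Q (ifLeqF _ _ C D)   = Every P Q C × Every P Q D
Every P Q (loop i C)         = Q i × Every P Q C

varTarget arrTarget fvarTarget farrTarget : Op → Maybe ℕ
varTarget (set i _)     = just i
varTarget (mov i _)     = just i
varTarget (inc i)       = just i
varTarget (plus i _ _)  = just i
varTarget (minus i _ _) = just i
varTarget (get i _ _)   = just i
varTarget (readN i)     = just i
varTarget _             = nothing
arrTarget (put a _ _)   = just a
arrTarget _             = nothing
fvarTarget (movF i _)    = just i
fvarTarget (getF i _ _)  = just i
fvarTarget (readF i)     = just i
fvarTarget (zeroF i)     = just i
fvarTarget (plusF i _ _) = just i
fvarTarget _             = nothing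
farrTarget (putF a _ _) = just a
farrTarget _            = nothing

Spares : ℕ → Maybe ℕ → Set
Spares v nothing  = ⊤
Spares v (just i) = T (not (v ≡ᵇ i))

KeepsVar KeepsArr KeepsFvar KeepsFarr : ℕ → Cmd → Set
KeepsVar v  = Every (Spares v ∘ varTarget) (Spares v ∘ just)
KeepsArr a  = Every (Spares a ∘ arrTarget) (λ _ → ⊤)
KeepsFvar v = Every (Spares v ∘ fvarTarget) (λ _ → ⊤)
KeepsFarr a = Every (Spares a ∘ farrTarget) (λ _ → ⊤)

takesCost : Op → Bool
takesCost (readF _) = true
takesCost _         = false

ReadsNoCost : Cmd → Set
ReadsNoCost = Every (T ∘ not ∘ takesCost) (λ _ → ⊤)

isVar isArray : ℕ → Set
isVar i   = T (i <ᵇ 24)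
isArray a = T (a <ᵇ 16)

WellFormedOp : Op → Set
WellFormedOp (set i _)     = isVar i
WellFormedOp (mov i j)     = isVar i × isVar j
WellFormedOp (movF i j)    = isVar i × isVar j
WellFormedOp (inc i)       = isVar i
WellFormedOp (plus i j k)  = isVar i × isVar j × isVar k
WellFormedOp (minus i j k) = isVar i × isVar j × isVar k
WellFormedOp (get i a j)   = isVar i × isArray a × isVar j
WellFormedOp (getF i a j)  = isVar i × isArray a × isVar j
WellFormedOp (put a i j)   = isArray a × isVar i × isVar j
WellFormedOp (putF a i j)  = isArray a × isVar i × isVar j
WellFormedOp (readN i)     = isVar i
WellFormedOp (readF i)    = isVar i
WellFormedOp (zeroF i)     = isVar i
WellFormedOp (plusF i j k) = isVar i × isVar j × isVar k

WellFormed : Cmd → Set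
WellFormed skip               = ⊤
WellFormed (op o)             = WellFormedOp o
WellFormed (C ⨾ D)            = WellFormed C × WellFormed D
WellFormed (ifPositive i C D) = isVar i × WellFormed C × WellFormed D
WellFormed (ifLeqF i j C D)   = isVar i × isVar j × WellFormed C × WellFormed D
WellFormed (loop i C)         = isVar i × KeepsVar i C × WellFormed C

-- Cells 0 to 23 hold the variables and cells 24 and 25 are scratch; the arrays
-- are interleaved above cell 32.

base : ℕ → ℕ
base i = let i₁ = 2 + i ; i₂ = i₁ + i₁ ; i₄ = i₂ + i₂ ; i₈ = i₄ + i₄ in i₈ + i₈

address : ℕ → ℕ → ℕ
address a i = base i + a

-- Multiplication by 16 is four doublings. `base` repeats them literally, so the value left in cell
-- 24 is an `address` by definition.
addressCode : ℕ → ℕ → List Instr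
addressCode a j =
  const 24 2 ∷ add 24 24 j ∷ add 24 24 24 ∷ add 24 24 24 ∷ add 24 24 24 ∷ add 24 24 24 ∷
  const 25 a ∷ add 24 24 25 ∷ []

-- Translation of commands into machine code

codeOp : Op → List Instr
codeOp (set i k)     = const i k ∷ []
codeOp (mov i j)     = const 24 j ∷ loadᴺ i 24 ∷ []
codeOp (movF i j)    = const 24 j ∷ loadᴿ i 24 ∷ []
codeOp (inc i)       = const 24 1 ∷ add i 24 i ∷ []
codeOp (plus i j k)  = add i j k ∷ []
codeOp (minus i j k) = sub i j k ∷ []
codeOp (get i a j)   = addressCode a j ++ loadᴺ i 24 ∷ []
codeOp (getF i a j)  = addressCode a j ++ loadᴿ i 24 ∷ []
codeOp (put a i j)   = addressCode a i ++ storeᴺ 24 j ∷ []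
codeOp (putF a i j)  = addressCode a i ++ storeᴿ 24 j ∷ []
codeOp (readN i)     = read i ∷ []
codeOp (readF i)    = readᴿ i ∷ []
codeOp (zeroF i)     = zeroᴿ i ∷ []
codeOp (plusF i j k) = addᴿ i j k ∷ []

-- Summands stand in the order in which positions accumulate: the code goes on at `size C + l` after
-- `C` and at `size D + (size C + l)` after `D`, so that the position equations are mostly
-- associativity.
size : Cmd → ℕ
size skip               = 0
size (op o)             = length (codeOp o)
size (C ⨾ D)            = size D + size C
size (ifPositive i C D) = size C + suc (size D + 1)
size (ifLeqF i j C D)   = size C + suc (size D + 1)
size (loop i C)         = 5 + size C

-- Jump targets are absolute, hence the parameter `l`, the position of the first instruction. The
-- machine jumps if a test succeeds, so the second branch of a conditional comes first and ends with
-- a jump over the other. A loop tests its counter before decrementing it.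
code : ℕ → Cmd → List Instr
code l skip               = []
code l (op o)             = codeOp o
code l (C ⨾ D)            = code l C ++ code (size C + l) D
code l (ifPositive i C D) = ifPos i (suc (size D + suc l)) ∷ code (suc l) D
  ++ goto (size C + suc (size D + suc l)) ∷ code (suc (size D + suc l)) C
code l (ifLeqF i j C D)   = ifLeqᴿ i j (suc (size D + suc l)) ∷ code (suc l) D
  ++ goto (size C + suc (size D + suc l)) ∷ code (suc (size D + suc l)) C
code l (loop i C)         = ifPos i (2 + l) ∷ goto (5 + size C + l) ∷ const 24 1 ∷ sub i i 24 ∷
  code (4 + l) C ++ goto l ∷ []

length-branches : ∀ (d : List Instr) ι c {m n} → length d ≡ m → length c ≡ n →
  suc (length (d ++ ι ∷ c)) ≡ n + suc (m + 1)
length-branches d ι c refl refl = begin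
  suc (length (d ++ ι ∷ c))           ≡⟨ cong suc (List.length-++ d) ⟩
  suc (length d + suc (length c))     ≡⟨ cong suc (+-suc (length d) (length c)) ⟩
  suc (suc (length d) + length c)     ≡⟨ cong suc (+-comm (suc (length d)) (length c)) ⟩
  suc (length c + suc (length d))     ≡⟨ +-suc (length c) (suc (length d)) ⟨
  length c + suc (1 + length d)       ≡⟨ cong (λ x → length c + suc x) (+-comm 1 (length d)) ⟩
  length c + suc (length d + 1)       ∎
  where open ≡-Reasoning

length-code : ∀ l C → length (code l C) ≡ size C
length-code l skip    = refl
length-code l (op o)  = refl
length-code l (C ⨾ D) = trans (List.length-++ (code l C))
  (trans (cong₂ _+_ (length-code l C) (length-code _ D)) (+-comm (size C) (size D)))
length-code l (ifPositive i C D) =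
  length-branches (code (suc l) D) (goto _) (code _ C) (length-code (suc l) D) (length-code _ C)
length-code l (ifLeqF i j C D)   =
  length-branches (code (suc l) D) (goto _) (code _ C) (length-code (suc l) D) (length-code _ C)
length-code l (loop i C) = cong (4 +_) (trans (List.length-++ (code (4 + l) C))
  (trans (cong (_+ 1) (length-code (4 + l) C)) (+-comm (size C) 1)))

-- Placement of code inside a program

At : Program → ℕ → List Instr → Set
At P l []      = ⊤
At P l (ι ∷ c) = fetch P l ≡ just ι × At P (suc l) c

At-++⁻ : ∀ {P} l c {d} → At P l (c ++ d) → At P l c × At P (length c + l) d
At-++⁻ l []      at       = tt , at
At-++⁻ {P} l (ι ∷ c) {d} (e , at) with At-++⁻ (suc l) c at
... | atc , atd = (e , atc) , subst (λ x → At P x d) (+-suc (length c) l) atd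

At-code⁻ : ∀ {P} l C {d} → At P l (code l C ++ d) → At P l (code l C) × At P (size C + l) d
At-code⁻ {P} l C {d} at with At-++⁻ l (code l C) at
... | atC , atd = atC , subst (λ x → At P (x + l) d) (length-code l C) atd

At-self : ∀ P → At P 0 P
At-self P = go [] P
  where
  fetch-++ : ∀ (c : Program) {ι d} → fetch (c ++ ι ∷ d) (length c) ≡ just ι
  fetch-++ []      = refl
  fetch-++ (_ ∷ c) = fetch-++ c

  go : ∀ c d → At (c ++ d) (length c) d
  go c []      = tt
  go c (ι ∷ d) = fetch-++ c , subst₂ (λ P l → At P l d) (++-snoc c) (length-snoc c) (go (c ++ ι ∷ []) d)
    where
    ++-snoc : ∀ c → (c ++ ι ∷ []) ++ d ≡ c ++ ι ∷ d
    ++-snoc []      = refl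
    ++-snoc (x ∷ c) = cong (x ∷_) (++-snoc c)
    length-snoc : ∀ (c : Program) → length (c ++ ι ∷ []) ≡ suc (length c)
    length-snoc []      = refl
    length-snoc (x ∷ c) = cong suc (length-snoc c)

fetch-end : ∀ P → fetch P (length P) ≡ nothing
fetch-end []      = refl
fetch-end (_ ∷ P) = fetch-end P

-- Disjointness of the memory cells

base≡ : ∀ i → base i ≡ (2 + i) * 16
base≡ i = begin
  i₈ + i₈        ≡⟨ twice i₈ ⟨
  i₈ * 2         ≡⟨ cong (_* 2) (twice i₄) ⟨
  i₄ * 2 * 2     ≡⟨ *-assoc i₄ 2 2 ⟩
  i₄ * 4         ≡⟨ cong (_* 4) (twice i₂) ⟨
  i₂ * 2 * 4     ≡⟨ *-assoc i₂ 2 4 ⟩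
  i₂ * 8         ≡⟨ cong (_* 8) (twice (2 + i)) ⟨
  (2 + i) * 2 * 8 ≡⟨ *-assoc (2 + i) 2 8 ⟩
  (2 + i) * 16 ∎
  where
  open ≡-Reasoning
  i₂ = (2 + i) + (2 + i)
  i₄ = i₂ + i₂
  i₈ = i₄ + i₄
  twice : ∀ x → x * 2 ≡ x + x
  twice x = trans (*-comm x 2) (cong (x +_) (+-identityʳ x))

32≤address : ∀ a i → 32 ≤ address a i
32≤address a i = ≤-trans (subst (32 ≤_) (sym (base≡ i)) (m≤m+n 32 (i * 16))) (m≤m+n (base i) a)

-- Uniqueness of quotient and remainder: in an `address` the array number is the remainder and the
-- index, shifted by two, is the quotient.
*16-injective : ∀ x y {a b} → a < 16 → b < 16 → x * 16 + a ≡ y * 16 + b → x ≡ y × a ≡ b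
*16-injective zero    zero    _  _  eq = refl , eq
*16-injective zero    (suc y) {a} {b} a< _ eq =
  contradiction (subst (16 ≤_) (sym eq) (m≤m+n 16 (y * 16 + b))) (<⇒≱ a<)
*16-injective (suc x) zero    {a} {b} _ b< eq =
  contradiction (subst (16 ≤_) eq (m≤m+n 16 (x * 16 + a))) (<⇒≱ b<)
*16-injective (suc x) (suc y) a< b< eq with *16-injective x y a< b< (+-cancelˡ-≡ 16 _ _ eq)
... | x≡y , a≡b = cong suc x≡y , a≡b

address-injective : ∀ {a b i j} → a < 16 → b < 16 → address a i ≡ address b j → i ≡ j × a ≡ b
address-injective {a} {b} {i} {j} a< b< eq
  with *16-injective (2 + i) (2 + j) a< b<
         (trans (cong (_+ a) (sym (base≡ i))) (trans eq (cong (_+ b) (base≡ j))))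
... | i≡j , a≡b = suc-injective (suc-injective i≡j) , a≡b

module _ {ℓ} {A : Set ℓ} where

  -- Generic in the contents of cells, so that one set of lemmas serves both banks.
  record Represents (v : ℕ → A) (a : ℕ → ℕ → A) (X : ℕ → A) : Set ℓ where
    field
      vars : ∀ i → isVar i → v i ≡ X i
      arrs : ∀ b → isArray b → ∀ i → a b i ≡ X (address b i)
  open Represents

  isVar≢address : ∀ {k} → k < 32 → ∀ b i → address b i ≢ k
  isVar≢address k<32 b i refl = <⇒≱ k<32 (32≤address b i)

  represents-scratch : ∀ {v a} X k x → 24 ≤ k → k < 32 →
    Represents v a X → Represents v a (X [ k ↦ x ])
  represents-scratch X k x 24≤k k<32 r .vars i i< = trans (vars r i i<)
    (sym (update-other X x λ { refl → <⇒≱ (<ᵇ⇒< i 24 i<) 24≤k }))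
  represents-scratch X k x 24≤k k<32 r .arrs b b< i = trans (arrs r b b< i)
    (sym (update-other X x (isVar≢address k<32 b i)))

  represents-var : ∀ {v a X} k {x y} → isVar k → x ≡ y →
    Represents v a X → Represents (v [ k ↦ x ]) a (X [ k ↦ y ])
  represents-var {v} {X = X} k {x} k< refl r .vars i i< with i ≟ k
  ... | yes refl = trans (update-same v i x) (sym (update-same X i x))
  ... | no i≢k   = trans (update-other v x i≢k) (trans (vars r i i<) (sym (update-other X x i≢k)))
  represents-var {X = X} k {x} k< refl r .arrs b b< i = trans (arrs r b b< i)
    (sym (update-other X x (isVar≢address (≤-trans (<ᵇ⇒< k 24 k<) (m≤m+n 24 8)) b i)))

  represents-arr : ∀ {v a X} b {i j x y} → isArray b → i ≡ j → x ≡ y →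
    Represents v a X → Represents v (a [ b ↦ (a b) [ i ↦ x ] ]) (X [ address b j ↦ y ])
  represents-arr {X = X} b {i} {x = x} b< refl refl r .vars k k< = trans (vars r k k<)
    (sym (update-other X x λ eq → isVar≢address (≤-trans (<ᵇ⇒< k 24 k<) (m≤m+n 24 8)) b i (sym eq)))
  represents-arr {a = a} {X} b {i} {x = x} b< refl refl r .arrs b′ b′< i′ with b′ ≟ b
  ... | no b′≢b = trans (cong (λ f → f i′) (update-other a _ b′≢b)) (trans (arrs r b′ b′< i′)
      (sym (update-other X x
        λ eq → b′≢b (proj₂ (address-injective {b′} {b} {i′} {i} (<ᵇ⇒< b′ 16 b′<) (<ᵇ⇒< b 16 b<) eq)))))
  ... | yes refl with i′ ≟ i
  ...   | yes refl = trans (cong (λ f → f i) (update-same a b _))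
      (trans (update-same (a b) i x) (sym (update-same X (address b i) x)))
  ...   | no i′≢i  = trans (cong (λ f → f i′) (update-same a b _))
      (trans (update-other (a b) x i′≢i) (trans (arrs r b′ b′< i′) (sym (update-other X x
        λ eq → i′≢i (proj₁ (address-injective {b} {b} {i′} {i} (<ᵇ⇒< b 16 b<) (<ᵇ⇒< b 16 b<) eq))))))

-- Breadth-first search

module Distance {n : ℕ} (G : Graph n) where
  open Graph G

  dist-walk : ∀ u v → Walk Adj (dist G u v) u v
  dist-walk u v = proj₁ (proj₂ (least (λ k → walk? G k u v) (proj₁ (connected u v)) (proj₂ (connected u v))))

  dist-minimal : ∀ {k u v} → Walk Adj k u v → dist G u v ≤ k
  dist-minimal {k} {u} {v} w = ≮⇒≥ λ k<d →
    proj₂ (proj₂ (least (λ k → walk? G k u v) (proj₁ (connected u v)) (proj₂ (connected u v)))) k<d w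

  dist-refl : ∀ v → dist G v v ≡ 0
  dist-refl v = n≤0⇒n≡0 (dist-minimal {0} refl)

  dist≡0⇒≡ : ∀ {u v} → dist G u v ≡ 0 → u ≡ v
  dist≡0⇒≡ {u} {v} d≡0 = subst (λ k → Walk Adj k u v) d≡0 (dist-walk u v)

  dist-adjacent : ∀ {u w} v → Adj u w → dist G u v ≤ suc (dist G w v)
  dist-adjacent {u} {w} v e = dist-minimal {suc _} (w , e , dist-walk w v)

  dist-step : ∀ {k u v} → dist G u v ≡ suc k → ∃ λ w → Adj u w × dist G w v ≡ k
  dist-step {k} {u} {v} d≡ with subst (λ k → Walk Adj k u v) d≡ (dist-walk u v)
  ... | w , e , p = w , e , ≤-antisym (dist-minimal p)
    (s≤s⁻¹ (subst (_≤ _) d≡ (dist-adjacent v e)))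

  -- The state of a breadth-first search from s: the cells Q 0, …, Q (t-1) form
  -- the queue, of which the first h have been served, and D holds the distance
  -- plus one at visited vertices, zero elsewhere.
  record Search (s : Fin n) (D Q : ℕ → ℕ) (h t : ℕ) : Set where
    field
      h≤t     : h ≤ t
      queued  : ∀ i → i < t → ∃ λ v → Q i ≡ toℕ v × D (toℕ v) ≡ suc (dist G v s)
      visited : ∀ v → D (toℕ v) ≢ 0 → ∃ λ i → i < t × Q i ≡ toℕ v
      inj     : ∀ {i j} → i < t → j < t → Q i ≡ Q j → i ≡ j
      sorted  : ∀ {i j} → i ≤ j → j < t → D (Q i) ≤ D (Q j)
      window  : ∀ {i j} → i < t → h ≤ j → j < t → D (Q i) ≤ suc (D (Q j))
      closed  : ∀ {i u v} → i < h → Q i ≡ toℕ u → Adj u v → D (toℕ v) ≢ 0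
      source  : D (toℕ s) ≢ 0

    D-visited : ∀ {v} → D (toℕ v) ≢ 0 → D (toℕ v) ≡ suc (dist G v s)
    D-visited {v} Dv≢0 with visited v Dv≢0
    ... | i , i<t , Qi≡v with queued i i<t
    ...   | u , Qi≡u , Du with Fin.toℕ-injective (trans (sym Qi≡v) Qi≡u)
    ...     | refl = Du

    D-queued : ∀ {i} → i < t → D (Q i) ≢ 0
    D-queued {i} i<t Di≡0 with queued i i<t
    ... | v , Qi≡v , Dv = contradiction (trans (sym Dv) (trans (cong D (sym Qi≡v)) Di≡0)) λ ()

    -- Induction on the distance: the next vertex on a shortest walk from v to s is nearer, hence
    -- already served, so `closed` makes v visited. The label of v is smaller than that of the head
    -- u, and `sorted` then excludes a position from h onwards.
    visited-before : ∀ {u} → h < t → Q h ≡ toℕ u → ∀ k {v} → dist G v s ≡ k → k < dist G u s →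
      ∃ λ i → i < h × Q i ≡ toℕ v
    visited-before {u} h<t Qh≡u k {v} d≡k k<du =
      let Dv≢0 = seen k d≡k k<du
          i , i<t , Qi≡v = visited v Dv≢0
      in i , ≰⇒> (λ h≤i → <⇒≱ (s≤s (subst (_< dist G u s) (sym d≡k) k<du))
           (subst₂ _≤_ (trans (cong D Qh≡u) (D-visited λ Du≡0 → D-queued h<t (trans (cong D Qh≡u) Du≡0)))
                       (trans (cong D Qi≡v) (D-visited Dv≢0)) (sorted h≤i i<t))) , Qi≡v
      where
      seen : ∀ k {v} → dist G v s ≡ k → k < dist G u s → D (toℕ v) ≢ 0
      seen zero    d≡0 _    with refl ← dist≡0⇒≡ d≡0 = source
      seen (suc k) d≡  k<du with dist-step d≡
      ... | w , e , dw≡k with visited-before h<t Qh≡u k dw≡k (<⇒≤ k<du)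
      ...   | i , i<h , Qi≡w = closed i<h Qi≡w (symmetric e)

    -- This justifies the label given to new vertices. If w were no farther than u, the next vertex
    -- on a shortest walk from w to s would be strictly nearer than u, hence served, and `closed`
    -- would make w visited.
    D-next : ∀ {u w} → h < t → Q h ≡ toℕ u → Adj u w → D (toℕ w) ≡ 0 → dist G w s ≡ suc (dist G u s)
    D-next {u} {w} h<t Qh≡u e Dw≡0 = ≤-antisym (dist-adjacent s (symmetric e)) (≰⇒> far)
      where
      far : ¬ dist G w s ≤ dist G u s
      far dw≤du with dist G w s in dw≡
      ... | zero  with refl ← dist≡0⇒≡ dw≡ = source Dw≡0
      ... | suc k with dist-step dw≡
      ...   | w′ , e′ , dw′≡k with visited-before h<t Qh≡u k dw′≡k dw≤du
      ...     | i , i<h , Qi≡w′ = closed i<h Qi≡w′ (symmetric e′) Dw≡0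

    -- Once every queue entry is served, being visited spreads from the source backwards along
    -- walks.
    all-visited : t ≤ h → ∀ v → D (toℕ v) ≢ 0
    all-visited t≤h v = along _ (proj₂ (connected v s))
      where
      along : ∀ k {v} → Walk Adj k v s → D (toℕ v) ≢ 0
      along zero    refl        = source
      along (suc k) (w , e , p) with visited w (along k p)
      ... | i , i<t , Qi≡w = closed (≤-trans i<t t≤h) Qi≡w (symmetric e)

    t≤n : t ≤ n
    t≤n = Fin.injective⇒≤ {f = vertex} λ {i} {j} eq → Fin.toℕ-injective
      (inj (Fin.toℕ<n i) (Fin.toℕ<n j) (trans (at i) (trans (cong toℕ eq) (sym (at j)))))
      where
      vertex : Fin t → Fin n
      vertex i = proj₁ (queued (toℕ i) (Fin.toℕ<n i))
      at : ∀ i → Q (toℕ i) ≡ toℕ (vertex i)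
      at i = proj₁ (proj₂ (queued (toℕ i) (Fin.toℕ<n i)))

    -- An exhausted queue would mean that all n vertices are visited, hence queued and served. So
    -- the outer loop can make n rounds without testing for emptiness.
    h<n⇒h<t : h < n → h < t
    h<n⇒h<t h<n = ≰⇒> λ t≤h → <⇒≱ h<n (≤-trans (n≤t (all-visited t≤h)) t≤h)
      where
      n≤t : (∀ v → D (toℕ v) ≢ 0) → n ≤ t
      n≤t all = Fin.injective⇒≤ {f = λ v → fromℕ< (proj₁ (proj₂ (visited v (all v))))} λ {u} {v} eq →
        Fin.toℕ-injective (trans (sym (proj₂ (proj₂ (visited u (all u)))))
          (trans (cong Q (Fin.fromℕ<-injective _ _ _ _ eq)) (proj₂ (proj₂ (visited v (all v))))))

    finished : h ≡ n → ∀ v → D (toℕ v) ≡ suc (dist G v s)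
    finished refl v = D-visited (all-visited t≤n v)

  open Search

  search-start : ∀ s D Q → (∀ v → D (toℕ v) ≡ 0) → Search s (D [ toℕ s ↦ 1 ]) (Q [ 0 ↦ toℕ s ]) 0 1
  search-start s D Q D≡0 = record
    { h≤t     = z≤n
    ; queued  = λ { zero _ → s , refl , trans (update-same D (toℕ s) 1) (cong suc (sym (dist-refl s)))
                  ; (suc _) (s≤s ()) }
    ; visited = λ v Dv≢0 → 0 , z<s , cong toℕ (only v Dv≢0)
    ; inj     = λ { (s≤s z≤n) (s≤s z≤n) _ → refl }
    ; sorted  = λ { z≤n (s≤s z≤n) → ≤-refl }
    ; window  = λ { (s≤s z≤n) z≤n (s≤s z≤n) → n≤1+n _ }
    ; closed  = λ ()
    ; source  = λ eq → contradiction (trans (sym (update-same D (toℕ s) 1)) eq) λ ()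
    }
    where
    only : ∀ v → (D [ toℕ s ↦ 1 ]) (toℕ v) ≢ 0 → s ≡ v
    only v Dv≢0 with v Fin.≟ s
    ... | yes v≡s = sym v≡s
    ... | no  v≢s = contradiction (trans (update-other D 1 (λ eq → v≢s (Fin.toℕ-injective eq))) (D≡0 v)) Dv≢0

  serve : ∀ {s D Q h t u} → Search s D Q h t → h < t → Q h ≡ toℕ u → (∀ {v} → Adj u v → D (toℕ v) ≢ 0) →
    Search s D Q (suc h) t
  serve {D = D} {Q} {h} {t} {u} S h<t Qh≡u nbrs = record
    { Search S
    ; h≤t    = h<t
    ; window = λ i<t h<j j<t → window S i<t (<⇒≤ h<j) j<t
    ; closed = closed′
    }
    where
    closed′ : ∀ {i u v} → i < suc h → Q i ≡ toℕ u → Adj u v → D (toℕ v) ≢ 0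
    closed′ {i} i<1+h Qi≡ e with m≤n⇒m<n∨m≡n (s≤s⁻¹ i<1+h)
    ... | inj₁ i<h  = closed S i<h Qi≡ e
    ... | inj₂ refl with Fin.toℕ-injective (trans (sym Qh≡u) Qi≡)
    ...   | refl = nbrs e

  -- The new label is one more than that of the head. By `window` no queued label exceeds it, so
  -- appending keeps the queue sorted; by `sorted` no unserved label is below that of the head, so
  -- `window` is kept as well.
  visit : ∀ {s D Q h t u w} → Search s D Q h t → h < t → Q h ≡ toℕ u → Adj u w → D (toℕ w) ≡ 0 →
    Search s (D [ toℕ w ↦ suc (suc (dist G u s)) ]) (Q [ t ↦ toℕ w ]) h (suc t)
  visit {s} {D} {Q} {h} {t} {u} {w} S h<t Qh≡u e Dw≡0 = record
    { h≤t     = m≤n⇒m≤1+n (h≤t S)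
    ; queued  = queued′
    ; visited = visited′
    ; inj     = inj′
    ; sorted  = sorted′
    ; window  = window′
    ; closed  = λ {i} i<h Qi≡ e′ → grow (closed S i<h (trans (sym (Q-old (≤-trans i<h (h≤t S)))) Qi≡) e′)
    ; source  = grow (source S)
    }
    where
    new : ℕ
    new = suc (suc (dist G u s))
    D′ Q′ : ℕ → ℕ
    D′ = D [ toℕ w ↦ new ]
    Q′ = Q [ t ↦ toℕ w ]

    D-new : D′ (toℕ w) ≡ new
    D-new = update-same D (toℕ w) new
    D-old : ∀ {v} → D v ≢ 0 → D′ v ≡ D v
    D-old Dv≢0 = update-other D new λ { refl → Dv≢0 Dw≡0 }
    Q-new : Q′ t ≡ toℕ w
    Q-new = update-same Q t (toℕ w)
    Q-old : ∀ {i} → i < t → Q′ i ≡ Q i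
    Q-old i<t = update-other Q (toℕ w) (<⇒≢ i<t)
    DQ-old : ∀ {i} → i < t → D′ (Q′ i) ≡ D (Q i)
    DQ-old i<t = trans (cong D′ (Q-old i<t)) (D-old (D-queued S i<t))
    DQ-new : D′ (Q′ t) ≡ new
    DQ-new = trans (cong D′ Q-new) D-new
    Dh : suc (D (Q h)) ≡ new
    Dh = cong suc (trans (cong D Qh≡u) (D-visited S λ Du≡0 → D-queued S h<t (trans (cong D Qh≡u) Du≡0)))

    grow : ∀ {v} → D v ≢ 0 → D′ v ≢ 0
    grow Dv≢0 eq = Dv≢0 (trans (sym (D-old Dv≢0)) eq)

    fresh : ∀ {i} → i < t → Q i ≢ toℕ w
    fresh i<t Qi≡w = D-queued S i<t (trans (cong D Qi≡w) Dw≡0)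

    queued′ : ∀ i → i < suc t → ∃ λ v → Q′ i ≡ toℕ v × D′ (toℕ v) ≡ suc (dist G v s)
    queued′ i i<1+t with m≤n⇒m<n∨m≡n (s≤s⁻¹ i<1+t)
    ... | inj₂ refl = w , Q-new , trans D-new (cong suc (sym (D-next S h<t Qh≡u e Dw≡0)))
    ... | inj₁ i<t with queued S i i<t
    ...   | v , Qi≡v , Dv = v , trans (Q-old i<t) Qi≡v , trans (D-old λ Dv≡0 → 0≢1+n (trans (sym Dv≡0) Dv)) Dv

    visited′ : ∀ v → D′ (toℕ v) ≢ 0 → ∃ λ i → i < suc t × Q′ i ≡ toℕ v
    visited′ v D′v≢0 with v Fin.≟ w
    ... | yes refl = t , ≤-refl , Q-new
    ... | no v≢w with visited S v (λ Dv≡0 → D′v≢0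
          (trans (update-other D new λ eq → v≢w (Fin.toℕ-injective eq)) Dv≡0))
    ...   | i , i<t , Qi≡v = i , m<n⇒m<1+n i<t , trans (Q-old i<t) Qi≡v

    inj′ : ∀ {i j} → i < suc t → j < suc t → Q′ i ≡ Q′ j → i ≡ j
    inj′ i<1+t j<1+t eq with m≤n⇒m<n∨m≡n (s≤s⁻¹ i<1+t) | m≤n⇒m<n∨m≡n (s≤s⁻¹ j<1+t)
    ... | inj₁ i<t  | inj₁ j<t  = inj S i<t j<t (trans (sym (Q-old i<t)) (trans eq (Q-old j<t)))
    ... | inj₁ i<t  | inj₂ refl = contradiction (trans (sym (Q-old i<t)) (trans eq Q-new)) (fresh i<t)
    ... | inj₂ refl | inj₁ j<t  = contradiction (trans (sym (Q-old j<t)) (trans (sym eq) Q-new)) (fresh j<t)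
    ... | inj₂ refl | inj₂ refl = refl

    below : ∀ {i} → i < t → D′ (Q′ i) ≤ new
    below i<t = subst₂ _≤_ (sym (DQ-old i<t)) Dh (window S i<t ≤-refl h<t)

    sorted′ : ∀ {i j} → i ≤ j → j < suc t → D′ (Q′ i) ≤ D′ (Q′ j)
    sorted′ {i} i≤j j<1+t with m≤n⇒m<n∨m≡n (s≤s⁻¹ j<1+t)
    ... | inj₁ j<t = subst₂ _≤_ (sym (DQ-old (≤-<-trans i≤j j<t))) (sym (DQ-old j<t)) (sorted S i≤j j<t)
    ... | inj₂ refl with m≤n⇒m<n∨m≡n i≤j
    ...   | inj₁ i<t  = ≤-trans (below i<t) (≤-reflexive (sym DQ-new))
    ...   | inj₂ refl = ≤-refl

    above : ∀ {j} → h ≤ j → j < suc t → new ≤ suc (D′ (Q′ j))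
    above {j} h≤j j<1+t with m≤n⇒m<n∨m≡n (s≤s⁻¹ j<1+t)
    ... | inj₁ j<t  = subst₂ _≤_ Dh (cong suc (sym (DQ-old j<t))) (s≤s (sorted S h≤j j<t))
    ... | inj₂ refl = subst (λ x → new ≤ suc x) (sym DQ-new) (n≤1+n new)

    window′ : ∀ {i j} → i < suc t → h ≤ j → j < suc t → D′ (Q′ i) ≤ suc (D′ (Q′ j))
    window′ i<1+t h≤j j<1+t with m≤n⇒m<n∨m≡n (s≤s⁻¹ i<1+t)
    ... | inj₁ i<t  = ≤-trans (below i<t) (above h≤j j<1+t)
    ... | inj₂ refl = ≤-trans (≤-reflexive DQ-new) (above h≤j j<1+t)

-- Degrees and edges

module _ {c ℓ} (M : CommutativeMonoid c ℓ) where
  open CommutativeMonoid M renaming (_∙_ to _⊕_; sym to ≈-sym; trans to ≈-trans; refl to ≈-refl)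
  open Sum M using (sum; sum-remove; sum-cong-≋)
  open import Relation.Binary.Reasoning.Setoid setoid

  -- Stated without subtraction, so that it serves both for natural numbers (the potential of a
  -- search) and for costs (the growth of a load by one vertex).
  sum-replace : ∀ {n} (f g : Fin n → Carrier) i → (∀ j → j ≢ i → f j ≈ g j) → sum f ⊕ g i ≈ sum g ⊕ f i
  sum-replace {suc n} f g i f≈g = begin
    sum f ⊕ g i             ≈⟨ ∙-congʳ (sum-remove {i = i} f) ⟩
    (f i ⊕ rest f) ⊕ g i    ≈⟨ ∙-congʳ (∙-congˡ (sum-cong-≋ λ j → f≈g _ (Fin.punchInᵢ≢i i j))) ⟩
    (f i ⊕ rest g) ⊕ g i    ≈⟨ comm _ _ ⟩
    g i ⊕ (f i ⊕ rest g)    ≈⟨ ∙-congˡ (comm _ _) ⟩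
    g i ⊕ (rest g ⊕ f i)    ≈⟨ assoc _ _ _ ⟨
    (g i ⊕ rest g) ⊕ f i    ≈⟨ ∙-congʳ (sum-remove {i = i} g) ⟨
    sum g ⊕ f i             ∎
    where
    rest : (Fin (suc n) → Carrier) → Carrier
    rest f = sum (f ∘ punchIn i)

open Sum +-0-commutativeMonoid using (sum)

n≤sum : ∀ {n} (f : Fin n → ℕ) → (∀ i → 1 ≤ f i) → n ≤ sum f
n≤sum {zero}  f 1≤f = z≤n
n≤sum {suc n} f 1≤f = +-mono-≤ (1≤f zero) (n≤sum (f ∘ suc) (1≤f ∘ suc))

length-concat-tabulate : ∀ {a} {A : Set a} {n} (f : Fin n → List A) →
  length (List.concat (List.tabulate f)) ≡ sum (length ∘ f)
length-concat-tabulate {n = zero}  f = refl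
length-concat-tabulate {n = suc n} f =
  trans (List.length-++ (f zero)) (cong (length (f zero) +_) (length-concat-tabulate (f ∘ suc)))

module _ {a} {A : Set a} where

  unique-lookup-injective : ∀ {xs : List A} → UniqueList xs → ∀ i j → List.lookup xs i ≡ List.lookup xs j → i ≡ j
  unique-lookup-injective (x∉ AllPairs.∷ _) zero zero _ = refl
  unique-lookup-injective {_ ∷ xs} (x∉ AllPairs.∷ _) zero (suc j) eq =
    contradiction eq (All.lookup x∉ (List.∈-lookup {xs = xs} j))
  unique-lookup-injective {_ ∷ xs} (x∉ AllPairs.∷ _) (suc i) zero eq =
    contradiction (sym eq) (All.lookup x∉ (List.∈-lookup {xs = xs} i))
  unique-lookup-injective (_ AllPairs.∷ u) (suc i) (suc j) eq = cong suc (unique-lookup-injective u i j eq)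

  unique-length-≤ : ∀ {xs ys : List A} → UniqueList xs → (∀ {x} → x List.∈ xs → x List.∈ ys) →
    length xs ≤ length ys
  unique-length-≤ {xs} {ys} u xs⊆ys = Fin.injective⇒≤ {f = λ i → Any.index (position i)} λ {i} {j} eq →
    unique-lookup-injective u i j (trans (Any.lookup-index (position i))
      (trans (cong (List.lookup ys) eq) (sym (Any.lookup-index (position j)))))
    where
    position : ∀ i → List.lookup xs i List.∈ ys
    position i = xs⊆ys (List.∈-lookup {xs = xs} i)

module Degrees {n : ℕ} {G : Graph n} (A : AdjacencyLists G) where
  open Graph G using (Adj; adj?; symmetric; loopless; connected)
  open AdjacencyLists A

  degree : Fin n → ℕ
  degree v = length (nbrs v)

  degreeSum : ℕ
  degreeSum = sum degree

  adjacent : ∀ {u v} → u List.∈ nbrs v → Adj v u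
  adjacent {u} {v} = Equivalence.to (complete u v)

  n≤degreeSum : ∀ {a b : Fin n} → a ≢ b → n ≤ degreeSum
  n≤degreeSum {a} {b} a≢b = n≤sum degree λ v → nonEmpty (proj₁ (other v)) (proj₂ (other v))
    where
    other : ∀ v → ∃ λ u → u ≢ v
    other v with v Fin.≟ a
    ... | yes refl = b , a≢b ∘ sym
    ... | no  v≢a  = a , v≢a ∘ sym

    nonEmpty : ∀ {v} u → u ≢ v → 1 ≤ degree v
    nonEmpty {v} u u≢v with connected v u
    ... | zero  , refl = contradiction refl u≢v
    ... | suc _ , w , e , _ with nbrs v | Equivalence.from (complete w v) e
    ...   | _ ∷ _ | _ = s≤s z≤n

  private
    Edge : Set
    Edge = Fin n × Fin n

    -- Copies the filter of `Graph.size`, so that `length edges` is the number of edges by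
    -- definition.
    edge? : (e : Edge) → Dec (proj₁ e Fin.< proj₂ e × Adj (proj₁ e) (proj₂ e))
    edge? e = (proj₁ e Fin.<? proj₂ e) ×-dec adj? (proj₁ e) (proj₂ e)

    edges : List Edge
    edges = List.filter edge? (List.cartesianProduct (List.allFin n) (List.allFin n))

    tagged : Bool → List (Bool × Edge)
    tagged b = List.map (b ,_) edges

    length-tagged : ∀ b → length (tagged b) ≡ length edges
    length-tagged b = List.length-map (b ,_) edges

    arcs : List Edge
    arcs = List.concat (List.tabulate λ v → List.map (v ,_) (nbrs v))

    arcs-unique : UniqueList arcs
    arcs-unique = Unique.concat⁺ (All.tabulate⁺ λ v → Unique.map⁺ (λ { refl → refl }) (unique v))
      (AllPairs.tabulate⁺ λ u≢v → λ { (p , q) → disjoint u≢v p q })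
      where
      disjoint : ∀ {u v e} → u ≢ v → e List.∈ List.map (u ,_) (nbrs u) → ¬ e List.∈ List.map (v ,_) (nbrs v)
      disjoint u≢v p q with List.∈-map⁻ _ p | List.∈-map⁻ _ q
      ... | _ , _ , refl | _ , _ , refl = u≢v refl

    arc-adjacent : ∀ {e} → e List.∈ arcs → Adj (proj₁ e) (proj₂ e)
    arc-adjacent p with List.∈-concat⁻′ _ p
    ... | _ , e∈ , xs∈ with List.∈-tabulate⁻ {f = λ v → List.map (v ,_) (nbrs v)} xs∈
    ...   | v , refl with List.∈-map⁻ _ e∈
    ...     | u , u∈ , refl = adjacent u∈

    -- An arc is sent to its edge, smaller end first, together with a bit for its direction. As this
    -- is injective, all arcs fit into two copies of the edge list.
    orient : Edge → Bool × Edge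
    orient (u , v) with u Fin.<? v
    ... | yes _ = true , u , v
    ... | no  _ = false , v , u

    orient-injective : ∀ {e f} → orient e ≡ orient f → e ≡ f
    orient-injective {u , v} {x , y} eq with u Fin.<? v | x Fin.<? y
    orient-injective refl | yes _ | yes _ = refl
    orient-injective refl | no _  | no _  = refl
    orient-injective ()   | yes _ | no _
    orient-injective ()   | no _  | yes _

    orient∈ : ∀ {e} → Adj (proj₁ e) (proj₂ e) →
      orient e List.∈ tagged true ++ tagged false
    orient∈ {u , v} e with u Fin.<? v
    ... | yes u<v = List.∈-++⁺ˡ (List.∈-map⁺ _
      (List.∈-filter⁺ edge? (List.∈-cartesianProduct⁺ (List.∈-allFin u) (List.∈-allFin v)) (u<v , e)))
    ... | no u≮v  = List.∈-++⁺ʳ (tagged true) (List.∈-map⁺ _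
      (List.∈-filter⁺ edge? (List.∈-cartesianProduct⁺ (List.∈-allFin v) (List.∈-allFin u))
        (≤∧≢⇒< (≮⇒≥ u≮v) (λ eq → loopless (subst (λ w → Adj w v) (sym (Fin.toℕ-injective eq)) e)) , symmetric e)))

  degreeSum≤2*size : degreeSum ≤ 2 * Graph.size G
  degreeSum≤2*size = begin
    degreeSum                                  ≡⟨ Sum.sum-cong-≗ +-0-commutativeMonoid
                                                    (λ v → List.length-map (v ,_) (nbrs v)) ⟨
    sum (λ v → length (List.map (v ,_) (nbrs v))) ≡⟨ length-concat-tabulate (λ v → List.map (v ,_) (nbrs v)) ⟨
    length arcs                                ≡⟨ List.length-map orient arcs ⟨
    length (List.map orient arcs)              ≤⟨ unique-length-≤ (Unique.map⁺ orient-injective arcs-unique) included ⟩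
    length (tagged true ++ tagged false) ≡⟨ List.length-++ (tagged true) {tagged false} ⟩
    length (tagged true) + length (tagged false)
      ≡⟨ cong₂ _+_ (length-tagged true) (length-tagged false) ⟩
    length edges + length edges                ≡⟨ cong (length edges +_) (+-identityʳ _) ⟨
    2 * Graph.size G                           ∎
    where
    open ≤-Reasoning
    included : ∀ {x} → x List.∈ List.map orient arcs → x List.∈ tagged true ++ tagged false
    included p with List.∈-map⁻ orient p
    ... | _ , e∈ , refl = orient∈ (arc-adjacent e∈)

-- Territories

module Territories {n : ℕ} (G : Graph n) where

  -- Nearness is a comparison with each single site instead of the minimum `distTo`; in this form it
  -- can be built up site by site.
  Owns : ∀ {q} → Vec (Fin n) (suc q) → Fin (suc q) → Fin n → Set
  Owns S o u = (∀ j → dist G u (lookup S o) ≤ dist G u (lookup S j))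
             × (∀ j → j Fin.< o → dist G u (lookup S o) < dist G u (lookup S j))

  distTo≤ : ∀ {q} u (S : Vec (Fin n) (suc q)) i → distTo G u S ≤ dist G u (lookup S i)
  distTo≤ u (s ∷ [])     zero    = ≤-refl
  distTo≤ u (s ∷ t ∷ S)  zero    = m⊓n≤m _ _
  distTo≤ u (s ∷ t ∷ S)  (suc i) = ≤-trans (m⊓n≤n (dist G u s) _) (distTo≤ u (t ∷ S) i)

  ≤distTo : ∀ {q k} u (S : Vec (Fin n) (suc q)) → (∀ i → k ≤ dist G u (lookup S i)) → k ≤ distTo G u S
  ≤distTo u (s ∷ [])     k≤ = k≤ zero
  ≤distTo u (s ∷ t ∷ S)  k≤ = ⊓-glb (k≤ zero) (≤distTo u (t ∷ S) (k≤ ∘ suc))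

  owner-territory : ∀ {q} {S : Vec (Fin n) (suc q)} {o u} → Owns S o u → InTerritory G S o u
  owner-territory {S = S} {o} {u} (nearest , first) =
    d≡ , λ j j<o → ≤-<-trans (≤-reflexive (sym d≡)) (first j j<o)
    where
    d≡ : dist G u (lookup S o) ≡ distTo G u S
    d≡ = ≤-antisym (≤distTo u S nearest) (distTo≤ u S o)

  territory-unique : ∀ {q} {S : Vec (Fin n) (suc q)} {i j u} →
    InTerritory G S i u → InTerritory G S j u → i ≡ j
  territory-unique {i = i} {j} (di , fi) (dj , fj) with <-cmp (toℕ i) (toℕ j)
  ... | tri< i<j _ _ = contradiction (sym di) (<⇒≢ (fj i i<j))
  ... | tri≈ _ i≡j _ = Fin.toℕ-injective i≡j
  ... | tri> _ _ j<i = contradiction (sym dj) (<⇒≢ (fi j j<i))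

  -- An equation between Booleans, so that the summands of `load` can be rewritten in place.
  does-inTerritory? : ∀ {q} {S : Vec (Fin n) (suc q)} {o u} → Owns S o u → ∀ i →
    does (inTerritory? G S i u) ≡ does (o Fin.≟ i)
  does-inTerritory? {S = S} {o} {u} owns i = does-⇔
    (mk⇔ (territory-unique {S = S} (owner-territory {S = S} owns)) λ { refl → owner-territory {S = S} owns })
    (inTerritory? G S i u) (o Fin.≟ i)

  lookup-∷ʳ-inject₁ : ∀ {q} (S : Vec (Fin n) q) w i → lookup (S ∷ʳ w) (inject₁ i) ≡ lookup S i
  lookup-∷ʳ-inject₁ (s ∷ S) w zero    = refl
  lookup-∷ʳ-inject₁ (s ∷ S) w (suc i) = lookup-∷ʳ-inject₁ S w i

  lookup-∷ʳ-fromℕ : ∀ {q} (S : Vec (Fin n) q) w → lookup (S ∷ʳ w) (fromℕ q) ≡ w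
  lookup-∷ʳ-fromℕ []      w = refl
  lookup-∷ʳ-fromℕ (s ∷ S) w = lookup-∷ʳ-fromℕ S w

  module _ {q : ℕ} (S : Vec (Fin n) (suc q)) (w : Fin n) {o : Fin (suc q)} {u : Fin n} (owns : Owns S o u) where

    -- Every old site precedes w, so w must be strictly nearer than each of them. Being strictly
    -- nearer than the owner, which is nearest among them, is enough.
    owns-new : dist G u w < dist G u (lookup S o) → Owns (S ∷ʳ w) (fromℕ (suc q)) u
    owns-new d< rewrite lookup-∷ʳ-fromℕ S w = nearest , first
      where
      nearest : ∀ j → dist G u w ≤ dist G u (lookup (S ∷ʳ w) j)
      nearest j with view j
      ... | ‵fromℕ rewrite lookup-∷ʳ-fromℕ S w = ≤-refl
      ... | ‵inject₁ i rewrite lookup-∷ʳ-inject₁ S w i = ≤-trans (<⇒≤ d<) (proj₁ owns i)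

      first : ∀ j → j Fin.< fromℕ (suc q) → dist G u w < dist G u (lookup (S ∷ʳ w) j)
      first j j< with view j
      ... | ‵fromℕ = contradiction j< (n≮n _)
      ... | ‵inject₁ i rewrite lookup-∷ʳ-inject₁ S w i = <-≤-trans d< (proj₁ owns i)

    -- The last index never precedes that of the owner, so a tie with w leaves the owner in place.
    owns-old : dist G u (lookup S o) ≤ dist G u w → Owns (S ∷ʳ w) (inject₁ o) u
    owns-old d≤ rewrite lookup-∷ʳ-inject₁ S w o = nearest , first
      where
      nearest : ∀ j → dist G u (lookup S o) ≤ dist G u (lookup (S ∷ʳ w) j)
      nearest j with view j
      ... | ‵fromℕ rewrite lookup-∷ʳ-fromℕ S w = d≤
      ... | ‵inject₁ i rewrite lookup-∷ʳ-inject₁ S w i = proj₁ owns i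

      first : ∀ j → j Fin.< inject₁ o → dist G u (lookup S o) < dist G u (lookup (S ∷ʳ w) j)
      first j j< with view j
      ... | ‵fromℕ = contradiction j< (<⇒≯
        (subst₂ _<_ (sym (Fin.toℕ-inject₁ o)) (sym (Fin.toℕ-fromℕ (suc q))) (Fin.toℕ<n o)))
      ... | ‵inject₁ i rewrite lookup-∷ʳ-inject₁ S w i =
        proj₂ owns i (subst₂ _<_ (Fin.toℕ-inject₁ i) (Fin.toℕ-inject₁ o) j<)

-- Bounds for maxima in a total order

module Maximum {a ℓ₁ ℓ₂} (O : Bundles.TotalOrder a ℓ₁ ℓ₂) where
  open Bundles.TotalOrder O using (Carrier) renaming (_≤_ to _⊑_; refl to ⊑-refl; trans to ⊑-trans)
  open Max O using () renaming (_⊔_ to _⊔ᵒ_; x≤x⊔y to x⊑x⊔y; x≤y⊔x to x⊑y⊔x; ⊔-lub to ⊔ᵒ-lub)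

  ≤maximum : ∀ {n} (f : Fin (suc n) → Carrier) i → f i ⊑ Vec.foldr₁ _⊔ᵒ_ (Vec.tabulate f)
  ≤maximum {zero}  f zero    = ⊑-refl
  ≤maximum {suc n} f zero    = x⊑x⊔y _ _
  ≤maximum {suc n} f (suc i) = ⊑-trans (≤maximum (f ∘ suc) i) (x⊑y⊔x _ _)

  maximum≤ : ∀ {n x} (f : Fin (suc n) → Carrier) → (∀ i → f i ⊑ x) → Vec.foldr₁ _⊔ᵒ_ (Vec.tabulate f) ⊑ x
  maximum≤ {zero}  f f≤ = f≤ zero
  maximum≤ {suc n} f f≤ = ⊔ᵒ-lub (f≤ zero) (maximum≤ (f ∘ suc) (f≤ ∘ suc))

-- The algorithm

vAnswer vN vP vI vJ vX vH vT vU vDU vK vC vSource vFound vZ vW : ℕ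
-- Variable 0 is cell 0, from which the output is taken.
vAnswer = 0
vN      = 1
vP      = 2
vI      = 3
vJ      = 4
vX      = 5
vH      = 6
vT      = 7
vU      = 8
vDU     = 9
vK      = 10
vC      = 11
vSource = 12
vFound  = 13
vZ      = 14
vW      = 15

-- The neighbours of all vertices are stored behind the members of S.
aNbr aDeg aStart aDist aQueue aBest aOwner : ℕ
aNbr   = 0
aDeg   = 1
aStart = 2
aDist  = 3
aQueue = 4
aBest  = 5
aOwner = 6

fY fMax fBest aCost aLoad : ℕ
fY    = 0
fMax  = 1
fBest = 2
aCost = 0
aLoad = 1

-- `vDU` is the label for unvisited neighbours of the served vertex, one more than its own label. An
-- unvisited vertex has label zero, so `ifPositive` tests for it directly.
readNeighbour enqueue visitNeighbour fetchVertex clearDistances startSearch bfs : Cmd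
readNeighbour = op (plus vX vJ vK) ⨾ op (get vX aNbr vX) ⨾ op (get vZ aDist vX)
enqueue = op (put aDist vX vDU) ⨾ op (put aQueue vT vX) ⨾ op (inc vT)
visitNeighbour =
  readNeighbour ⨾
  ifPositive vZ skip enqueue
fetchVertex =
  op (get vU aQueue vH) ⨾ op (inc vH) ⨾ op (get vDU aDist vU) ⨾ op (inc vDU) ⨾
  op (get vJ aStart vU) ⨾ op (get vK aDeg vU)
clearDistances = op (set vZ 0) ⨾ op (mov vC vN) ⨾ loop vC (op (put aDist vC vZ))
startSearch =
  op (set vZ 1) ⨾ op (put aDist vSource vZ) ⨾ op (set vH 0) ⨾ op (put aQueue vH vSource) ⨾
  op (set vT 1) ⨾ op (mov vC vN)
bfs = clearDistances ⨾ startSearch ⨾ loop vC (fetchVertex ⨾ loop vK visitNeighbour)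

-- Sites come from last to first, so the newcomer has priority over all sites seen before: it claims
-- on equality and is refused only if strictly farther, that is, if `vDU` is positive.
claim compareSite addSite chooseOwners : Cmd
claim = op (put aBest vU vX) ⨾ op (put aOwner vU vI)
compareSite =
  op (get vX aDist vU) ⨾ op (get vZ aBest vU) ⨾ op (minus vDU vX vZ) ⨾
  ifPositive vZ (ifPositive vDU skip claim) claim
addSite = op (get vSource aNbr vI) ⨾ bfs ⨾ op (mov vU vN) ⨾ loop vU compareSite
chooseOwners = op (mov vI vP) ⨾ loop vI addSite

-- The added site has index `vP`, so there are `vP + 1` loads. The truncated difference in `locate`
-- is positive exactly if the vertex is strictly closer to the added site. `vFound` is a flag
-- because no field element can act as an infinite initial value.
clearLoads locate addCost addCosts takeLarger maximise evaluate keepBetter recordBest tryVertex findBest : Cmd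
clearLoads = op (zeroF fY) ⨾ op (mov vI vP) ⨾ op (inc vI) ⨾ loop vI (op (putF aLoad vI fY))
locate =
  op (get vX aDist vU) ⨾ op (get vZ aBest vU) ⨾ op (minus vZ vZ vX)
addCost =
  op (getF fY aCost vU) ⨾ op (getF fMax aLoad vX) ⨾ op (plusF fY fMax fY) ⨾ op (putF aLoad vX fY)
addCosts = op (mov vU vN) ⨾
  loop vU (locate ⨾ ifPositive vZ (op (mov vX vP)) (op (get vX aOwner vU)) ⨾ addCost)
takeLarger = op (getF fY aLoad vI) ⨾ ifLeqF fY fMax skip (op (movF fMax fY))
maximise = op (getF fMax aLoad vP) ⨾ op (mov vI vP) ⨾ loop vI takeLarger
evaluate = clearLoads ⨾ addCosts ⨾ maximise
recordBest = op (movF fBest fMax) ⨾ op (mov vAnswer vW) ⨾ op (set vFound 1)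
keepBetter = ifPositive vFound (ifLeqF fBest fMax skip recordBest) recordBest
tryVertex =
  -- `aBest` is the distance to S plus one, so `vX` becomes zero exactly at members of S.
  op (get vX aBest vW) ⨾ op (set vZ 1) ⨾ op (minus vX vX vZ) ⨾
  ifPositive vX (op (mov vSource vW) ⨾ bfs ⨾ evaluate ⨾ keepBetter) skip
findBest = op (mov vW vN) ⨾ loop vW tryVertex

readItem readVertexHead readVertex readCost readInput : Cmd
readItem = op (readN vX) ⨾ op (put aNbr vJ vX) ⨾ op (inc vJ)
readVertexHead = op (readN vK) ⨾ op (put aDeg vU vK) ⨾ op (put aStart vU vJ)
readVertex = readVertexHead ⨾ loop vK readItem ⨾ op (inc vU)
readCost = op (readF fY) ⨾ op (putF aCost vU fY) ⨾ op (inc vU)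
readInput =
  (op (readN vN) ⨾ op (readN vP) ⨾ op (mov vK vP)) ⨾ loop vK readItem ⨾
  op (mov vC vN) ⨾ loop vC readVertex ⨾
  (op (mov vC vN) ⨾ op (set vU 0)) ⨾ loop vC readCost

solver : Cmd
solver = readInput ⨾ chooseOwners ⨾ findBest

module _ {c ℓ₁ ℓ₂} (R : OrderedField c ℓ₁ ℓ₂) where

  open OrderedField R using (Carrier; 0#) renaming (_+_ to _+ᶠ_; _≤_ to _≤ᶠ_; _≤?_ to _≤ᶠ?_)
  open RAM R
  open Represents

  -- Semantics and cost of commands

  record State : Set c where
    constructor state
    field
      var   : ℕ → ℕ
      arr   : ℕ → ℕ → ℕ
      fvar  : ℕ → Carrier
      farr  : ℕ → ℕ → Carrier
      tape  : List ℕ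
      tapeᶠ : List Carrier
  open State public

  setVar : ℕ → ℕ → State → State
  setVar i x (state v a w b t u) = state (v [ i ↦ x ]) a w b t u

  varValue : Op → State → ℕ
  varValue (set i k)     s = k
  varValue (mov i j)     s = var s j
  varValue (inc i)       s = suc (var s i)
  varValue (plus i j k)  s = var s j + var s k
  varValue (minus i j k) s = var s j ∸ var s k
  varValue (get i a j)   s = arr s a (var s j)
  varValue (readN i)     s = proj₁ (next 0 (tape s))
  varValue _             s = 0

  arrValue : Op → State → ℕ → ℕ
  arrValue (put a i j) s = arr s a [ var s i ↦ var s j ]
  arrValue _           s = arr s 0

  fvarValue : Op → State → Carrier
  fvarValue (movF i j)    s = fvar s j
  fvarValue (getF i a j)  s = farr s a (var s j)
  fvarValue (plusF i j k) s = fvar s j +ᶠ fvar s k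
  fvarValue (readF i)     s = proj₁ (next 0# (tapeᶠ s))
  fvarValue _             s = 0#

  farrValue : Op → State → ℕ → Carrier
  farrValue (putF a i j) s = farr s a [ var s i ↦ fvar s j ]
  farrValue _            s = farr s 0

  tapeAfter : Op → List ℕ → List ℕ
  tapeAfter (readN _) t = proj₂ (next 0 t)
  tapeAfter _         t = t

  tapeᶠAfter : Op → List Carrier → List Carrier
  tapeᶠAfter o t = if takesCost o then proj₂ (next 0# t) else t

  assign : ∀ {a} {A : Set a} → Maybe ℕ → A → (ℕ → A) → ℕ → A
  assign nothing  x f = f
  assign (just i) x f = f [ i ↦ x ]

  -- Every component passes through `assign`, even where the operation has no target and the default
  -- value is ignored. This uniform shape reduces the frame properties of variables and arrays to
  -- `spares`.
  execOp : Op → State → State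
  execOp o s = record
    { var   = assign (varTarget o)  (varValue o s)  (var s)
    ; arr   = assign (arrTarget o)  (arrValue o s)  (arr s)
    ; fvar  = assign (fvarTarget o) (fvarValue o s) (fvar s)
    ; farr  = assign (farrTarget o) (farrValue o s) (farr s)
    ; tape  = tapeAfter o (tape s)
    ; tapeᶠ = tapeᶠAfter o (tapeᶠ s)
    }

  run  : Cmd → State → State
  repeat : ℕ → Cmd → ℕ → State → State

  run skip               s = s
  run (op o)             s = execOp o s
  run (C ⨾ D)            s = run D (run C s)
  run (ifPositive i C D) s = if does (0 <? var s i) then run C s else run D s
  run (ifLeqF i j C D)   s = if does (fvar s i ≤ᶠ? fvar s j) then run C s else run D s
  run (loop i C)         s = repeat i C (var s i) s

  repeat i C zero    s = s
  repeat i C (suc k) s = repeat i C k (run C (setVar i k s))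

  -- An upper bound: both branches of a conditional are charged.
  cost       : Cmd → State → ℕ
  repeatCost : ℕ → Cmd → ℕ → State → ℕ

  cost skip               s = 0
  cost (op o)             s = length (codeOp o)
  cost (C ⨾ D)            s = cost C s + cost D (run C s)
  cost (ifPositive i C D) s = 2 + (cost C s + cost D s)
  cost (ifLeqF i j C D)   s = 2 + (cost C s + cost D s)
  cost (loop i C)         s = repeatCost i C (var s i) s

  -- Leaving costs the test and the exit jump. A round costs the test, the loading of 1, the
  -- subtraction and the jump back, besides the body.
  repeatCost i C zero    s = 2
  repeatCost i C (suc k) s = 4 + cost C (setVar i k s) + repeatCost i C k (run C (setVar i k s))

  module _ {b} {B : Set b} (view : State → B) {P : Op → Set} {Q : ℕ → Set}
           (view-op  : ∀ o → P o → ∀ s → view (execOp o s) ≡ view s)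
           (view-set : ∀ i → Q i → ∀ k s → view (setVar i k s) ≡ view s) where

    exec-view   : ∀ C → Every P Q C → ∀ s → view (run C s) ≡ view s
    repeat-view : ∀ i C → Q i → Every P Q C → ∀ k s → view (repeat i C k s) ≡ view s

    exec-view skip               _       s = refl
    exec-view (op o)             p       s = view-op o p s
    exec-view (C ⨾ D)            (p , q) s = trans (exec-view D q _) (exec-view C p s)
    exec-view (ifPositive i C D) (p , q) s with does (0 <? var s i)
    ... | true  = exec-view C p s
    ... | false = exec-view D q s
    exec-view (ifLeqF i j C D)   (p , q) s with does (fvar s i ≤ᶠ? fvar s j)
    ... | true  = exec-view C p s
    ... | false = exec-view D q s
    exec-view (loop i C)         (q , p) s = repeat-view i C q p (var s i) s

    repeat-view i C q p zero    s = refl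
    repeat-view i C q p (suc k) s =
      trans (repeat-view i C q p k _) (trans (exec-view C p _) (view-set i q k s))

  spares : ∀ {a} {A : Set a} {v} i {x : A} f → Spares v i → assign i x f v ≡ f v
  spares         nothing  f _ = refl
  spares {v = v} (just i) {x} f v≢i = update-other f x λ { refl → T-not v≢i (≡⇒≡ᵇ v v refl) }
    where
    T-not : ∀ {b} → T (not b) → ¬ T b
    T-not {true} ()

  exec-var : ∀ {v} C → KeepsVar v C → ∀ s → var (run C s) v ≡ var s v
  exec-var {v} = exec-view (λ s → var s v) (λ o p s → spares (varTarget o) (var s) p)
    (λ i p k s → spares (just i) (var s) p)

  exec-arr : ∀ {a} C → KeepsArr a C → ∀ s → arr (run C s) a ≡ arr s a
  exec-arr {a} = exec-view (λ s → arr s a) (λ o p s → spares (arrTarget o) (arr s) p) (λ _ _ _ _ → refl)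

  exec-fvar : ∀ {v} C → KeepsFvar v C → ∀ s → fvar (run C s) v ≡ fvar s v
  exec-fvar {v} = exec-view (λ s → fvar s v) (λ o p s → spares (fvarTarget o) (fvar s) p) (λ _ _ _ _ → refl)

  exec-farr : ∀ {a} C → KeepsFarr a C → ∀ s → farr (run C s) a ≡ farr s a
  exec-farr {a} = exec-view (λ s → farr s a) (λ o p s → spares (farrTarget o) (farr s) p) (λ _ _ _ _ → refl)


  exec-tapeᶠ : ∀ C → ReadsNoCost C → ∀ s → tapeᶠ (run C s) ≡ tapeᶠ s
  exec-tapeᶠ = exec-view tapeᶠ untouched (λ _ _ _ _ → refl)
    where
    untouched : ∀ o → T (not (takesCost o)) → ∀ s → tapeᶠ (execOp o s) ≡ tapeᶠ s
    untouched o t s with takesCost o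
    ... | false = refl

  -- Correctness of the translation

  open Config

  -- These sequences may stop anywhere, not only where the program halts, and can therefore be
  -- concatenated.
  data Steps (P : Program) : Config → ℕ → Config → Set c where
    done : ∀ {σ} → Steps P σ 0 σ
    _◅_  : ∀ {σ σ′ t ι} → fetch P (pc σ) ≡ just ι → Steps P (exec ι σ) t σ′ → Steps P σ (suc t) σ′
  infixr 5 _◅_

  _◅◅_ : ∀ {P σ σ′ σ″ t t′} → Steps P σ t σ′ → Steps P σ′ t′ σ″ → Steps P σ (t + t′) σ″
  done     ◅◅ q = q
  (e ◅ p)  ◅◅ q = e ◅ (p ◅◅ q)

  halts : ∀ {P σ σ′ t} → Steps P σ t σ′ → fetch P (pc σ′) ≡ nothing → P ⊢ σ ⇓[ t ] σ′
  halts done    e = halt e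
  halts (d ◅ p) e = step d (halts p e)

  -- Silent about the program counter and the scratch cells, so that it survives jumps and address
  -- computations.
  record Simulates (s : State) (σ : Config) : Set c where
    field
      ints   : Represents (var s) (arr s) (X σ)
      reals  : Represents (fvar s) (farr s) (Y σ)
      tape≡  : tape s ≡ Config.tape σ
      tapeᶠ≡ : tapeᶠ s ≡ tapeᴿ σ
  open Simulates

  Reaches : Program → ℕ → ℕ → State → Config → Set c
  Reaches P end b s σ = ∃₂ λ t σ′ → Steps P σ t σ′ × t ≤ b × pc σ′ ≡ end × Simulates s σ′

  private
    scratch : ∀ {a} {A : Set a} {v ar} {f : ℕ → A} x → Represents v ar f → Represents v ar (f [ 24 ↦ x ])
    scratch {f = f} x = represents-scratch f 24 x ≤-refl (m≤m+n 25 7)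

    isVar≢24 : ∀ {i} → isVar i → i ≢ 24
    -- At `i = 24` the type of the hypothesis computes to the empty type.
    isVar≢24 i< refl = i<

    addressed : ∀ {P l X Y t r} a j {c v ar} → isVar j → At P l (addressCode a j ++ c) →
      Represents v ar X → ∃ λ X′ → Steps P (config l X Y t r) 8 (config (8 + l) X′ Y t r) ×
        At P (8 + l) c × X′ 24 ≡ address a (v j) × Represents v ar X′
    addressed {X = X} a j j< (e₁ , e₂ , e₃ , e₄ , e₅ , e₆ , e₇ , e₈ , at) rep =
      _ , e₁ ◅ e₂ ◅ e₃ ◅ e₄ ◅ e₅ ◅ e₆ ◅ e₇ ◅ e₈ ◅ done , at ,
      cong (address a) (trans (update-other X 2 (isVar≢24 j<)) (sym (vars rep j j<))) ,
      scratch _ (represents-scratch _ 25 a (m≤m+n 24 1) (m≤m+n 26 6)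
        (scratch _ (scratch _ (scratch _ (scratch _ (scratch _ (scratch _ rep)))))))

  op-reaches : ∀ {P l} o → WellFormedOp o → At P l (codeOp o) → ∀ s X Y t r →
    Simulates s (config l X Y t r) →
    Reaches P (length (codeOp o) + l) (length (codeOp o)) (execOp o s) (config l X Y t r)
  op-reaches (set i k) i< (e , _) s X Y t r sim = _ , _ , e ◅ done , ≤-refl , refl ,
    record { Simulates sim; ints = represents-var i i< refl (ints sim) }
  op-reaches (mov i j) (i< , j<) (e₁ , e₂ , _) s X Y t r sim = _ , _ , e₁ ◅ e₂ ◅ done , ≤-refl , refl ,
    record { Simulates sim
           ; ints = represents-var i i< (vars (scratch j (ints sim)) j j<) (scratch j (ints sim)) }
  op-reaches (movF i j) (i< , j<) (e₁ , e₂ , _) s X Y t r sim = _ , _ , e₁ ◅ e₂ ◅ done , ≤-refl , refl ,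
    record { Simulates sim; ints = scratch j (ints sim)
           ; reals = represents-var i i< (vars (reals sim) j j<) (reals sim) }
  op-reaches (inc i) i< (e₁ , e₂ , _) s X Y t r sim = _ , _ , e₁ ◅ e₂ ◅ done , ≤-refl , refl ,
    record { Simulates sim
           ; ints = represents-var i i< (cong suc (vars (scratch 1 (ints sim)) i i<)) (scratch 1 (ints sim)) }
  op-reaches (plus i j k) (i< , j< , k<) (e , _) s X Y t r sim = _ , _ , e ◅ done , ≤-refl , refl ,
    record { Simulates sim
           ; ints = represents-var i i< (cong₂ _+_ (vars (ints sim) j j<) (vars (ints sim) k k<)) (ints sim) }
  op-reaches (minus i j k) (i< , j< , k<) (e , _) s X Y t r sim = _ , _ , e ◅ done , ≤-refl , refl ,
    record { Simulates sim
           ; ints = represents-var i i< (cong₂ _∸_ (vars (ints sim) j j<) (vars (ints sim) k k<)) (ints sim) }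
  op-reaches (get i a j) (i< , a< , j<) at s X Y t r sim with addressed a j j< at (ints sim)
  ... | X′ , p , (e , _) , X′24 , rep = _ , _ , p ◅◅ (e ◅ done) , ≤-refl , refl ,
    record { Simulates sim
           ; ints = represents-var i i< (trans (arrs rep a a< _) (cong X′ (sym X′24))) rep }
  op-reaches (getF i a j) (i< , a< , j<) at s X Y t r sim with addressed a j j< at (ints sim)
  ... | X′ , p , (e , _) , X′24 , rep = _ , _ , p ◅◅ (e ◅ done) , ≤-refl , refl ,
    record { Simulates sim; ints = rep
           ; reals = represents-var i i< (trans (arrs (reals sim) a a< _) (cong Y (sym X′24))) (reals sim) }
  op-reaches (put a i j) (a< , i< , j<) at s X Y t r sim with addressed a i i< at (ints sim)
  ... | X′ , p , (e , _) , X′24 , rep = _ , _ , p ◅◅ (e ◅ done) , ≤-refl , refl ,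
    record { Simulates sim
           ; ints = subst (λ x → Represents _ _ (X′ [ x ↦ X′ j ])) (sym X′24)
                      (represents-arr a a< refl (vars rep j j<) rep) }
  op-reaches (putF a i j) (a< , i< , j<) at s X Y t r sim with addressed a i i< at (ints sim)
  ... | X′ , p , (e , _) , X′24 , rep = _ , _ , p ◅◅ (e ◅ done) , ≤-refl , refl ,
    record { Simulates sim; ints = rep
           ; reals = subst (λ x → Represents _ _ (Y [ x ↦ Y j ])) (sym X′24)
                      (represents-arr a a< refl (vars (reals sim) j j<) (reals sim)) }
  op-reaches (readN i) i< (e , _) s X Y t r sim = _ , _ , e ◅ done , ≤-refl , refl ,
    record { Simulates sim
           ; ints  = represents-var i i< (cong (proj₁ ∘ next 0) (tape≡ sim)) (ints sim)
           ; tape≡ = cong (proj₂ ∘ next 0) (tape≡ sim) }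
  op-reaches (readF i) i< (e , _) s X Y t r sim = _ , _ , e ◅ done , ≤-refl , refl ,
    record { Simulates sim
           ; reals  = represents-var i i< (cong (proj₁ ∘ next 0#) (tapeᶠ≡ sim)) (reals sim)
           ; tapeᶠ≡ = cong (proj₂ ∘ next 0#) (tapeᶠ≡ sim) }
  op-reaches (zeroF i) i< (e , _) s X Y t r sim = _ , _ , e ◅ done , ≤-refl , refl ,
    record { Simulates sim; reals = represents-var i i< refl (reals sim) }
  op-reaches (plusF i j k) (i< , j< , k<) (e , _) s X Y t r sim = _ , _ , e ◅ done , ≤-refl , refl ,
    record { Simulates sim
           ; reals = represents-var i i< (cong₂ _+ᶠ_ (vars (reals sim) j j<) (vars (reals sim) k k<)) (reals sim) }

  private
    jump : Config → ℕ → Config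
    jump (config _ X Y t r) l = config l X Y t r

    simulates-jump : ∀ {s σ} l → Simulates s σ → Simulates s (jump σ l)
    simulates-jump l sim = record { Simulates sim }

  run-reaches : ∀ {P l} C → WellFormed C → At P l (code l C) → ∀ s X Y t r →
    Simulates s (config l X Y t r) →
    Reaches P (size C + l) (cost C s) (run C s) (config l X Y t r)
  -- The recursion is on the number of rounds left. As the body keeps the counter variable, that
  -- variable holds this number at every return to the test.
  repeat-reaches : ∀ {P l} i C → WellFormed (loop i C) → At P l (code l (loop i C)) → ∀ k s X Y t r →
    var s i ≡ k → Simulates s (config l X Y t r) →
    Reaches P (size (loop i C) + l) (repeatCost i C k s) (repeat i C k s) (config l X Y t r)

  -- The two kinds of conditional have the same code after the test.
  branch-reaches : ∀ {P l} b C D → WellFormed C → WellFormed D →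
    At P (suc l) (code (suc l) D ++ goto (size C + suc (size D + suc l)) ∷ code (suc (size D + suc l)) C) →
    ∀ s X Y t r → Simulates s (config l X Y t r) →
    Reaches P (size C + suc (size D + 1) + l) (1 + (cost C s + cost D s)) (if b then run C s else run D s)
      (config (if b then suc (size D + suc l) else suc l) X Y t r)

  run-reaches skip _ _ s X Y t r sim = _ , _ , done , z≤n , refl , sim
  run-reaches (op o) wf at s X Y t r sim = op-reaches o wf at s X Y t r sim
  run-reaches {l = l} (C ⨾ D) (wfC , wfD) at s X Y t r sim with At-code⁻ l C at
  ... | atC , atD with run-reaches C wfC atC s X Y t r sim
  ...   | t₁ , config _ X₁ Y₁ n₁ r₁ , p₁ , t₁≤ , refl , sim₁
      with run-reaches D wfD atD _ X₁ Y₁ n₁ r₁ sim₁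
  ...   | t₂ , σ₂ , p₂ , t₂≤ , pc₂ , sim₂ =
    _ , σ₂ , p₁ ◅◅ p₂ , +-mono-≤ t₁≤ t₂≤ , trans pc₂ (sym (+-assoc (size D) (size C) l)) , sim₂
  run-reaches {l = l} (ifPositive i C D) (i< , wfC , wfD) (e , at) s X Y t r sim
    with branch-reaches (does (0 <? var s i)) C D wfC wfD at s X Y t r sim
  ... | t′ , σ′ , p , t≤ , pc≡ , sim′ =
    -- The machine tests a cell where `run` tests a variable; `vars` identifies the two.
    _ , σ′ , e ◅ subst (λ x → Steps _ (config (if does (0 <? x) then _ else _) X Y t r) _ _) (vars (ints sim) i i<) p ,
    s≤s t≤ , pc≡ , sim′
  run-reaches {l = l} (ifLeqF i j C D) (i< , j< , wfC , wfD) (e , at) s X Y t r sim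
    with branch-reaches (does (fvar s i ≤ᶠ? fvar s j)) C D wfC wfD at s X Y t r sim
  ... | t′ , σ′ , p , t≤ , pc≡ , sim′ =
    _ , σ′ , e ◅ subst₂ (λ x y → Steps _ (config (if does (x ≤ᶠ? y) then _ else _) X Y t r) _ _)
      (vars (reals sim) i i<) (vars (reals sim) j j<) p ,
    s≤s t≤ , pc≡ , sim′
  run-reaches (loop i C) wf at s X Y t r sim = repeat-reaches i C wf at (var s i) s X Y t r refl sim

  branch-reaches {l = l} true C D wfC wfD at s X Y t r sim with At-code⁻ (suc l) D at
  ... | _ , (_ , atC) with run-reaches C wfC atC s X Y t r (simulates-jump _ sim)
  ...   | t₁ , σ₁ , p , t₁≤ , pc₁ , sim₁ = t₁ , σ₁ , p ,
    ≤-trans t₁≤ (≤-trans (m≤m+n _ _) (n≤1+n _)) ,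
    trans pc₁ (trans (cong (λ x → size C + suc x) (sym (+-assoc (size D) 1 l)))
                     (sym (+-assoc (size C) _ l))) , sim₁
  branch-reaches {l = l} false C D wfC wfD at s X Y t r sim with At-code⁻ (suc l) D at
  ... | atD , (e , _) with run-reaches D wfD atD s X Y t r (simulates-jump _ sim)
  ...   | t₁ , config _ X₁ Y₁ n₁ r₁ , p , t₁≤ , refl , sim₁ = t₁ + 1 , _ , p ◅◅ (e ◅ done) ,
    ≤-trans (+-monoˡ-≤ 1 t₁≤) (≤-trans (≤-reflexive (+-comm (cost D s) 1)) (s≤s (m≤n+m (cost D s) (cost C s)))) ,
    trans (cong (λ x → size C + suc x) (sym (+-assoc (size D) 1 l)))
                     (sym (+-assoc (size C) _ l)) , simulates-jump _ sim₁

  repeat-reaches {P} {l} i C (i< , _ , _) (e₁ , e₂ , _) zero s X Y t r k≡ sim =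
    2 , _ , e₁ ◅ subst (λ x → Steps P (config (if does (0 <? x) then 2 + l else suc l) X Y t r) 1
                                    (config (5 + size C + l) X Y t r)) 0≡ (e₂ ◅ done) ,
    ≤-refl , refl , simulates-jump _ sim
    where
    0≡ : 0 ≡ X i
    0≡ = trans (sym k≡) (vars (ints sim) i i<)
  repeat-reaches {P} {l} i C wf@(i< , keeps , wfC) at@(e₁ , e₂ , e₃ , e₄ , at′) (suc k) s X Y t r k≡ sim
    with At-code⁻ (4 + l) C at′
  ... | atC , (e₅ , _) with run-reaches C wfC atC (setVar i k s) (X [ 24 ↦ 1 ] [ i ↦ (X [ 24 ↦ 1 ]) i ∸ 1 ]) Y t r
        record { Simulates sim
               ; ints = represents-var {X = X [ 24 ↦ 1 ]} i i<
                   (cong (_∸ 1) (trans (sym k≡) (vars (scratch {f = X} 1 (ints sim)) i i<)))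
                                            (scratch {f = X} 1 (ints sim)) }
  ...   | t₁ , config _ X₁ Y₁ n₁ r₁ , p₁ , t₁≤ , refl , sim₁
      with repeat-reaches i C wf at k (run C (setVar i k s)) X₁ Y₁ n₁ r₁
             (trans (exec-var C keeps (setVar i k s)) (update-same (var s) i k)) (simulates-jump l sim₁)
  ...   | t₂ , σ₂ , p₂ , t₂≤ , pc₂ , sim₂ =
    3 + (t₁ + suc t₂) , σ₂ ,
    e₁ ◅ subst (λ x → Steps P (config (if does (0 <? x) then 2 + l else suc l) X Y t r) _ _)
           (trans (sym k≡) (vars (ints sim) i i<)) (e₃ ◅ e₄ ◅ (p₁ ◅◅ (e₅ ◅ p₂))) ,
    ≤-trans (≤-reflexive (cong (3 +_) (+-suc t₁ t₂))) (+-monoʳ-≤ 4 (+-mono-≤ t₁≤ t₂≤)) , pc₂ , sim₂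

  initial : List ℕ → List Carrier → State
  initial = state (λ _ → 0) (λ _ _ → 0) (λ _ → 0#) (λ _ _ → 0#)

  -- The state and the answer variable are given up to an equation because a
  -- conversion problem about the run of a concrete program is intractable.
  compiled : ∀ {v q} {V : Set v} {answer : V → ℕ} {Q : V → Set q} {b t r i} C s →
    WellFormed C → s ≡ initial t r → i ≡ 0 →
    cost C s ≤ b × (∃ λ x → var (run C s) i ≡ answer x × Q x) →
    ∃ λ k → ∃ λ σ → ∃ λ x → (code 0 C ⊢ start t r ⇓[ k ] σ) × (k ≤ b) × (output σ ≡ answer x) × Q x
  compiled {t = t} {r} C _ wf refl refl (cost≤ , x , answer≡ , Qx)
    with run-reaches C wf (At-self (code 0 C)) (initial t r) (λ _ → 0) (λ _ → 0#) t r
      record { ints  = record { vars = λ _ _ → refl; arrs = λ _ _ _ → refl }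
             ; reals = record { vars = λ _ _ → refl; arrs = λ _ _ _ → refl }
             ; tape≡ = refl ; tapeᶠ≡ = refl }
  ... | k , σ , p , k≤ , pc≡ , sim =
    k , σ , x , halts p end , ≤-trans k≤ cost≤ , trans (sym (vars (ints sim) 0 tt)) answer≡ , Qx
    where
    end : fetch (code 0 C) (pc σ) ≡ nothing
    end = subst (λ l → fetch (code 0 C) l ≡ nothing)
      (sym (trans pc≡ (trans (+-identityʳ (size C)) (sym (length-code 0 C))))) (fetch-end (code 0 C))

  -- Proof rules for conditionals and loops

  ifPositive-elim : ∀ {p} (Q : State → Set p) i C D s →
    (var s i ≢ 0 → Q (run C s)) → (var s i ≡ 0 → Q (run D s)) → Q (run (ifPositive i C D) s)
  ifPositive-elim Q i C D s yes′ no′ with var s i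
  ... | zero  = no′ refl
  ... | suc _ = yes′ λ ()

  ifLeqF-elim : ∀ {p} (Q : State → Set p) i j C D s →
    (fvar s i ≤ᶠ fvar s j → Q (run C s)) → (¬ fvar s i ≤ᶠ fvar s j → Q (run D s)) →
    Q (run (ifLeqF i j C D) s)
  ifLeqF-elim Q i j C D s yes′ no′ with fvar s i ≤ᶠ? fvar s j
  ... | yes p = yes′ p
  ... | no ¬p = no′ ¬p

  -- An amortised rule: the invariant mentions the credit r still available, and each round hands on
  -- what it has not spent, so that savings recorded in the invariant can cover an expensive round.
  -- The 4 is the overhead of a round, the 2 that of leaving.
  repeat-credit : ∀ {p} i C (I : ℕ → ℕ → State → Set p) n →
    (∀ k r s → k < n → I (suc k) r s →
      ∃ λ r′ → 4 + cost C (setVar i k s) + r′ ≤ r × I k r′ (run C (setVar i k s))) →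
    ∀ k r s → k ≤ n → I k r s → repeatCost i C k s ≤ 2 + r × ∃ λ r′ → I 0 r′ (repeat i C k s)
  repeat-credit i C I n body zero    r s _   inv = m≤m+n 2 r , r , inv
  repeat-credit i C I n body (suc k) r s k<n inv with body k r s k<n inv
  ... | r′ , paid , inv′ with repeat-credit i C I n body k r′ _ (<⇒≤ k<n) inv′
  ...   | cost≤ , final = ≤-trans (+-monoʳ-≤ c₁ cost≤)
    (≤-trans (≤-reflexive (trans (sym (+-assoc c₁ 2 r′)) (trans (cong (_+ r′) (+-comm c₁ 2)) (+-assoc 2 c₁ r′))))
      (+-monoʳ-≤ 2 paid)) , final
    where
    c₁ : ℕ
    c₁ = 4 + cost C (setVar i k s)

  loop-credit : ∀ {p} i C (I : ℕ → ℕ → State → Set p) n →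
    (∀ k r s → k < n → I (suc k) r s →
      ∃ λ r′ → 4 + cost C (setVar i k s) + r′ ≤ r × I k r′ (run C (setVar i k s))) →
    ∀ r s → var s i ≡ n → I n r s → cost (loop i C) s ≤ 2 + r × ∃ λ r′ → I 0 r′ (run (loop i C) s)
  loop-credit i C I n body r s refl inv = repeat-credit i C I n body n r s ≤-refl inv

  -- Here the credit is `4 + b` for each round left.
  loop-invariant : ∀ {p} i C (I : ℕ → State → Set p) b n →
    (∀ k s → k < n → I (suc k) s → cost C (setVar i k s) ≤ b × I k (run C (setVar i k s))) →
    ∀ s → var s i ≡ n → I n s → cost (loop i C) s ≤ 2 + n * (4 + b) × I 0 (run (loop i C) s)
  loop-invariant i C I b n body s i≡n inv
    with loop-credit i C (λ k r s → r ≡ k * (4 + b) × I k s) n advance (n * (4 + b)) s i≡n (refl , inv)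
    where
    advance : ∀ k r s → k < n → r ≡ suc k * (4 + b) × I (suc k) s →
      ∃ λ r′ → 4 + cost C (setVar i k s) + r′ ≤ r × r′ ≡ k * (4 + b) × I k (run C (setVar i k s))
    advance k r s k<n (refl , inv) with body k s k<n inv
    ... | cost≤ , inv′ = k * (4 + b) , +-monoˡ-≤ (k * (4 + b)) (+-monoʳ-≤ 4 cost≤) , refl , inv′
  ... | cost≤ , _ , _ , final = cost≤ , final

  -- Reading lists of numbers and costs

  readItems-spec : ∀ {m} (f : Fin m → ℕ) {rest} s → var s vK ≡ m → tape s ≡ List.tabulate f ++ rest →
    cost (loop vK readItem) s ≤ 2 + m * 16 ×
    tape (run (loop vK readItem) s) ≡ rest × var (run (loop vK readItem) s) vJ ≡ var s vJ + m ×
    (∀ i → arr (run (loop vK readItem) s) aNbr (var s vJ + toℕ i) ≡ f i) ×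
    (∀ x → x < var s vJ → arr (run (loop vK readItem) s) aNbr x ≡ arr s aNbr x)
  readItems-spec {m} f {rest} s refl = items f s
    where
    items : ∀ {m} (f : Fin m → ℕ) s → tape s ≡ List.tabulate f ++ rest → let s′ = repeat vK readItem m s in
      repeatCost vK readItem m s ≤ 2 + m * 16 ×
      tape s′ ≡ rest × var s′ vJ ≡ var s vJ + m ×
      (∀ i → arr s′ aNbr (var s vJ + toℕ i) ≡ f i) × (∀ x → x < var s vJ → arr s′ aNbr x ≡ arr s aNbr x)
    items {zero}  f s t≡ = ≤-refl , t≡ , sym (+-identityʳ _) , (λ ()) , λ _ _ → refl
    items {suc m} f s t≡
      with items (f ∘ suc) (run readItem (setVar vK m s)) (cong (proj₂ ∘ RAM.next R 0) t≡)
    -- An item takes 12 steps and 4 of loop overhead. Writing moves upwards, so cells below the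
    -- value of `vJ` on entry keep their contents.
    ... | cost≤ , tape≡ , vJ≡ , stored , kept = +-monoʳ-≤ 16 cost≤ , tape≡ , trans vJ≡ (sym (+-suc (var s vJ) m)) ,
      stored′ , λ x x<j → trans (kept x (m<n⇒m<1+n x<j)) (update-other (arr s aNbr) _ (<⇒≢ x<j))
      where
      stored′ : ∀ i → arr (repeat vK readItem (suc m) s) aNbr (var s vJ + toℕ i) ≡ f i
      stored′ zero    = trans (cong (arr (repeat vK readItem (suc m) s) aNbr) (+-identityʳ (var s vJ)))
        (trans (kept (var s vJ) ≤-refl)
          (trans (update-same (arr s aNbr) (var s vJ) _) (cong (proj₁ ∘ RAM.next R 0) t≡)))
      stored′ (suc i) = trans (cong (arr (repeat vK readItem (suc m) s) aNbr) (+-suc (var s vJ) (toℕ i))) (stored i)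

  readCosts-spec : ∀ {m} (f : Fin m → Carrier) s → var s vC ≡ m → tapeᶠ s ≡ List.tabulate f →
    cost (loop vC readCost) s ≤ 2 + m * 16 ×
    (∀ i → farr (run (loop vC readCost) s) aCost (var s vU + toℕ i) ≡ f i)
  readCosts-spec {m} f s refl t≡ = let cost≤ , stored , _ = reads f s t≡ in cost≤ , stored
    where
    reads : ∀ {m} (f : Fin m → Carrier) s → tapeᶠ s ≡ List.tabulate f → let s′ = repeat vC readCost m s in
      repeatCost vC readCost m s ≤ 2 + m * 16 ×
      (∀ i → farr s′ aCost (var s vU + toℕ i) ≡ f i) × (∀ x → x < var s vU → farr s′ aCost x ≡ farr s aCost x)
    reads {zero}  f s t≡ = ≤-refl , (λ ()) , λ _ _ → refl
    reads {suc m} f s t≡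
      with reads (f ∘ suc) (run readCost (setVar vC m s)) (cong (proj₂ ∘ RAM.next R 0#) t≡)
    ... | cost≤ , stored , kept = +-monoʳ-≤ 16 cost≤ ,
      stored′ , λ x x<u → trans (kept x (m<n⇒m<1+n x<u)) (update-other (farr s aCost) _ (<⇒≢ x<u))
      where
      stored′ : ∀ i → farr (repeat vC readCost (suc m) s) aCost (var s vU + toℕ i) ≡ f i
      stored′ zero    = trans (cong (farr (repeat vC readCost (suc m) s) aCost) (+-identityʳ (var s vU)))
        (trans (kept (var s vU) ≤-refl)
          (trans (update-same (farr s aCost) (var s vU) _) (cong (proj₁ ∘ RAM.next R 0#) t≡)))
      stored′ (suc i) = trans (cong (farr (repeat vC readCost (suc m) s) aCost) (+-suc (var s vU) (toℕ i))) (stored i)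

  module _ (I : Instance R) (A : AdjacencyLists (Instance.graph I)) where
    open Instance I renaming (graph to G)
    open AdjacencyLists A
    open Graph G using (Adj)
    open Degrees A
    open Distance G
    open Search
    open Territories G

    -- Correctness and running time of the algorithm

    -- The input as laid out in memory. Everything executed after the reading phase satisfies
    -- `KeepsInput`, so `loaded-run` can carry this record along.
    record Loaded (s : State) : Set c where
      field
        n≡         : var s vN ≡ n
        p≡         : var s vP ≡ suc q
        members    : ∀ i → arr s aNbr (toℕ i) ≡ toℕ (lookup S i)
        degrees    : ∀ v → arr s aDeg (toℕ v) ≡ degree v
        neighbours : ∀ v j → arr s aNbr (arr s aStart (toℕ v) + toℕ j) ≡ toℕ (List.lookup (nbrs v) j)
        costs      : ∀ v → farr s aCost (toℕ v) ≡ π v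
    open Loaded

    KeepsInput : Cmd → Set
    KeepsInput C = KeepsVar vN C × KeepsVar vP C ×
      KeepsArr aNbr C × KeepsArr aDeg C × KeepsArr aStart C × KeepsFarr aCost C

    loaded-run : ∀ C → KeepsInput C → ∀ {s} → Loaded s → Loaded (run C s)
    loaded-run C (kn , kp , kb , kd , ks , kc) {s} L = record
      { n≡         = trans (exec-var C kn s) (n≡ L)
      ; p≡         = trans (exec-var C kp s) (p≡ L)
      ; members    = λ i → trans (cong (λ f → f (toℕ i)) (exec-arr C kb s)) (members L i)
      ; degrees    = λ v → trans (cong (λ f → f (toℕ v)) (exec-arr C kd s)) (degrees L v)
      ; neighbours = λ v j → trans (cong₂ (λ f g → f (g (toℕ v) + toℕ j)) (exec-arr C kb s) (exec-arr C ks s))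
                                   (neighbours L v j)
      ; costs      = λ v → trans (cong (λ f → f (toℕ v)) (exec-farr C kc s)) (costs L v)
      }

    -- Breadth-first search as a command

    clearDistances-spec : ∀ s → Loaded s →
      cost clearDistances s ≤ 5 + n * 13 × (∀ v → arr (run clearDistances s) aDist (toℕ v) ≡ 0)
    clearDistances-spec s L =
      +-monoʳ-≤ 3 (proj₁ spec) , λ v → proj₂ (proj₂ spec) (toℕ v) z≤n (Fin.toℕ<n v)
      where
      Cleared : ℕ → State → Set
      Cleared k s = var s vZ ≡ 0 × (∀ i → k ≤ i → i < n → arr s aDist i ≡ 0)

      clear : ∀ k s → k < n → Cleared (suc k) s →
        9 ≤ 9 × Cleared k (run (op (put aDist vC vZ)) (setVar vC k s))
      clear k s k<n (z≡0 , cleared) = ≤-refl , z≡0 , at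
        where
        at : ∀ i → k ≤ i → i < n → (arr s aDist [ k ↦ var s vZ ]) i ≡ 0
        at i k≤i i<n with i ≟ k
        ... | yes refl = trans (update-same (arr s aDist) k _) z≡0
        ... | no  i≢k  = trans (update-other (arr s aDist) _ i≢k) (cleared i (≤∧≢⇒< k≤i (i≢k ∘ sym)) i<n)

      spec = loop-invariant vC (op (put aDist vC vZ)) Cleared 9 n clear
        (run (op (set vZ 0) ⨾ op (mov vC vN)) s) (n≡ L) (refl , λ i n≤i i<n → contradiction i<n (≤⇒≯ n≤i))

    -- u is the head of the queue and `Q₀` the queue when its service starts. Visits append behind
    -- position h; `stable` records this, and through it the head is still known after the loop over
    -- the neighbours.
    module Serve (x u : Fin n) (h : ℕ) (Q₀ : ℕ → ℕ) (Q₀h : Q₀ h ≡ toℕ u) where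

      record Visiting (k : ℕ) (s : State) : Set c where
        field
          vH≡    : var s vH ≡ suc h
          vJ≡    : var s vJ ≡ arr s aStart (toℕ u)
          vDU≡   : var s vDU ≡ suc (suc (dist G u x))
          h<vT   : h < var s vT
          search : Search x (arr s aDist) (arr s aQueue) h (var s vT)
          stable : ∀ i → i ≤ h → arr s aQueue i ≡ Q₀ i
          seen   : ∀ j → k ≤ toℕ j → arr s aDist (toℕ (List.lookup (nbrs u) j)) ≢ 0
      open Visiting

      visitNeighbour-spec : ∀ k s → k < degree u → Loaded s → Visiting (suc k) s →
        cost visitNeighbour (setVar vK k s) ≤ 41 × Visiting k (run visitNeighbour (setVar vK k s))
      visitNeighbour-spec k s k<d L V = ≤-refl , ifPositive-elim (Visiting k) vZ skip enqueue s₁ old new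
        where
        j : Fin (degree u)
        j = fromℕ< k<d
        w : Fin n
        w = List.lookup (nbrs u) j
        s₁ : State
        s₁ = run readNeighbour (setVar vK k s)

        vX≡ : var s₁ vX ≡ toℕ w
        vX≡ = trans (cong (arr s aNbr) (cong₂ _+_ (vJ≡ V) (sym (Fin.toℕ-fromℕ< k<d)))) (neighbours L u j)

        split : ∀ {D : ℕ → ℕ} → D (toℕ w) ≢ 0 → (∀ i → suc k ≤ toℕ i → D (toℕ (List.lookup (nbrs u) i)) ≢ 0) →
          ∀ i → k ≤ toℕ i → D (toℕ (List.lookup (nbrs u) i)) ≢ 0
        split Dw≢0 rest i k≤i with m≤n⇒m<n∨m≡n k≤i
        ... | inj₁ k<i = rest i k<i
        ... | inj₂ k≡i with Fin.toℕ-injective (trans (Fin.toℕ-fromℕ< k<d) k≡i)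
        ...   | refl = Dw≢0

        old : var s₁ vZ ≢ 0 → Visiting k s₁
        old Dw≢0 = record
          { vH≡ = vH≡ V ; vJ≡ = vJ≡ V ; vDU≡ = vDU≡ V ; h<vT = h<vT V ; search = search V ; stable = stable V
          ; seen = split {arr s aDist} (Dw≢0 ∘ trans (cong (arr s aDist) vX≡)) (seen V)
          }

        new : var s₁ vZ ≡ 0 → Visiting k (run enqueue s₁)
        new Dw≡0′ = record
          { vH≡ = vH≡ V ; vJ≡ = vJ≡ V ; vDU≡ = vDU≡ V ; h<vT = m<n⇒m<1+n (h<vT V)
          ; search = subst₂ (λ a b → Search x (arr s aDist [ a ↦ b ]) (arr s aQueue [ var s vT ↦ a ]) h (suc (var s vT)))
              (sym vX≡) (sym (vDU≡ V)) (visit (search V) (h<vT V) Qh≡u w-adj Dw≡0)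
          ; stable = λ i i≤h → trans (update-other (arr s aQueue) _ (<⇒≢ (≤-<-trans i≤h (h<vT V)))) (stable V i i≤h)
          ; seen = split {arr s aDist [ var s₁ vX ↦ var s vDU ]}
              (λ eq → contradiction (trans (sym (trans (trans (cong (λ a → (arr s aDist [ a ↦ var s vDU ]) (toℕ w)) vX≡)
                (update-same (arr s aDist) (toℕ w) _)) (vDU≡ V))) eq) λ ())
              λ i k<i eq → seen V i k<i (trans (sym (update-other (arr s aDist) _ (λ same →
                seen V i k<i (trans (cong (arr s aDist) same) Dw≡0′)))) eq)
          }
          where
          Dw≡0 : arr s aDist (toℕ w) ≡ 0
          Dw≡0 = trans (cong (arr s aDist) (sym vX≡)) Dw≡0′
          Qh≡u : arr s aQueue h ≡ toℕ u
          Qh≡u = trans (stable V h ≤-refl) Q₀h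
          w-adj : Adj u w
          w-adj = adjacent (List.∈-lookup {xs = nbrs u} j)

    loaded-setVar : ∀ i k → KeepsInput (op (set i 0)) → ∀ {s} → Loaded s → Loaded (setVar i k s)
    loaded-setVar i k keeps {s} L = loaded-run (op (set i k)) keeps L

    -- The potential of the search pays 56 for each queue entry not yet served
    -- and 45 for each of its arcs.
    record Searching (x : Fin n) (k r : ℕ) (s : State) : Set c where
      field
        h        : ℕ
        left     : Fin n → ℕ
        h+k≡n    : h + k ≡ n
        vH≡      : var s vH ≡ h
        search   : Search x (arr s aDist) (arr s aQueue) h (var s vT)
        unserved : ∀ v → (∀ i → i < h → arr s aQueue i ≢ toℕ v) → left v ≡ degree v
        paid     : k * 56 + sum left * 45 ≤ r
        loaded   : Loaded s

    -- By `inj` the head u occupies no earlier position, so its arcs have not been paid for yet.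
    -- Setting its share of the potential to zero releases `degree u * 45`, the price of the inner
    -- rounds.
    serve-spec : ∀ x k r s → k < n → Searching x (suc k) r s →
      ∃ λ r′ → 4 + cost (fetchVertex ⨾ loop vK visitNeighbour) (setVar vC k s) + r′ ≤ r ×
        Searching x k r′ (run (fetchVertex ⨾ loop vK visitNeighbour) (setVar vC k s))
    serve-spec x k r s k<n σ = k * 56 + sum left′ * 45 , within , record
      { h = suc h
      ; left = left′
      ; h+k≡n = trans (sym (+-suc h k)) h+k≡n
      ; vH≡ = Visiting.vH≡ after
      ; search = serve (Visiting.search after) (Visiting.h<vT after)
          (trans (Visiting.stable after h ≤-refl) Qh≡u) nbrs-seen
      ; unserved = unserved′
      ; paid = ≤-refl
      ; loaded = loaded′
      }
      where
      open Searching σ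
      h<t : h < var s vT
      h<t = h<n⇒h<t search (subst (h <_) h+k≡n (m<m+n h z<s))
      u : Fin n
      u = proj₁ (queued search h h<t)
      Qh≡u : arr s aQueue h ≡ toℕ u
      Qh≡u = proj₁ (proj₂ (queued search h h<t))
      vU≡ : arr s aQueue (var s vH) ≡ toℕ u
      vU≡ = trans (cong (arr s aQueue) vH≡) Qh≡u

      open Serve x u h (arr s aQueue) Qh≡u

      s₁ : State
      s₁ = run fetchVertex (setVar vC k s)
      vK≡ : var s₁ vK ≡ degree u
      vK≡ = trans (cong (arr s aDeg) vU≡) (degrees loaded u)

      s₂ : State
      s₂ = run (loop vK visitNeighbour) s₁

      visits : cost (loop vK visitNeighbour) s₁ ≤ 2 + degree u * 45 × Loaded s₂ × Visiting 0 s₂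
      visits = loop-invariant vK visitNeighbour (λ k s → Loaded s × Visiting k s) 41 (degree u)
        (λ { k s k<d (L , V) → let L′ = loaded-setVar vK k _ L in
             proj₁ (visitNeighbour-spec k s k<d L V) ,
             loaded-run visitNeighbour _ L′ , proj₂ (visitNeighbour-spec k s k<d L V) })
        s₁ vK≡ (loaded-run fetchVertex _ (loaded-setVar vC k _ loaded) , record
          { vH≡ = cong suc vH≡
          ; vJ≡ = cong (arr s aStart) vU≡
          ; vDU≡ = cong suc (trans (cong (arr s aDist) vU≡) (proj₂ (proj₂ (queued search h h<t))))
          ; h<vT = h<t
          ; search = search
          ; stable = λ _ _ → refl
          ; seen = λ j d≤j → contradiction (Fin.toℕ<n j) (≤⇒≯ d≤j)
          })

      loaded′ = proj₁ (proj₂ visits)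
      after   = proj₂ (proj₂ visits)

      nbrs-seen : ∀ {v} → Adj u v → arr s₂ aDist (toℕ v) ≢ 0
      nbrs-seen {v} e = subst (λ w → arr s₂ aDist (toℕ w) ≢ 0)
        (sym (Any.lookup-index v∈)) (Visiting.seen after (Any.index v∈) z≤n)
        where
        v∈ : v List.∈ nbrs u
        v∈ = Equivalence.from (complete v u) e

      left′ : Fin n → ℕ
      left′ v = if does (v Fin.≟ u) then 0 else left v

      left′-other : ∀ v → v ≢ u → left′ v ≡ left v
      left′-other v v≢u with v Fin.≟ u
      ... | yes v≡u = contradiction v≡u v≢u
      ... | no _    = refl

      left′-u : left′ u ≡ 0
      left′-u with u Fin.≟ u
      ... | yes _  = refl
      ... | no u≢u = contradiction refl u≢u

      left-u : left u ≡ degree u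
      left-u = unserved u λ i i<h Qi≡u →
        <⇒≢ i<h (inj search (<-trans i<h h<t) h<t (trans Qi≡u (sym Qh≡u)))

      unserved′ : ∀ v → (∀ i → i < suc h → arr s₂ aQueue i ≢ toℕ v) →
        left′ v ≡ degree v
      unserved′ v fresh = trans (left′-other v λ { refl → fresh h ≤-refl (trans (Visiting.stable after h ≤-refl) Qh≡u) })
        (unserved v λ i i<h Qi≡v → fresh i (m<n⇒m<1+n i<h) (trans (Visiting.stable after i (<⇒≤ i<h)) Qi≡v))

      sum-left : sum left′ + degree u ≡ sum left
      sum-left = trans (cong (sum left′ +_) (sym left-u))
        (trans (sum-replace +-0-commutativeMonoid left′ left u left′-other)
          (trans (cong (sum left +_) left′-u) (+-identityʳ _)))

      within : 4 + cost (fetchVertex ⨾ loop vK visitNeighbour) (setVar vC k s) + (k * 56 + sum left′ * 45) ≤ r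
      within = begin
        4 + (40 + cost (loop vK visitNeighbour) s₁) + (k * 56 + sum left′ * 45)
          ≤⟨ +-monoˡ-≤ _ (+-monoʳ-≤ 44 (proj₁ visits)) ⟩
        44 + (2 + degree u * 45) + (k * 56 + sum left′ * 45)
          -- Apart from its arcs a service takes 44 + 2 steps, so 10 of the reserved 56 remain.
          ≤⟨ m≤n+m _ 10 ⟩
        10 + (44 + (2 + degree u * 45) + (k * 56 + sum left′ * 45))
          ≡⟨ arith (degree u) k (sum left′) ⟩
        suc k * 56 + (sum left′ + degree u) * 45
          ≡⟨ cong (λ l → suc k * 56 + l * 45) {sum left′ + degree u} sum-left ⟩
        suc k * 56 + sum left * 45
          ≤⟨ paid ⟩
        r ∎
        where
        open ≤-Reasoning
        arith : ∀ d k l → 10 + (44 + (2 + d * 45) + (k * 56 + l * 45)) ≡ suc k * 56 + (l + d) * 45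
        arith = solve-∀

    n≤E : n ≤ degreeSum
    n≤E = n≤degreeSum {lookup S zero} {proj₁ candidate} λ eq →
      proj₂ candidate (subst (_∈ᵛ S) eq (∈-lookup zero S))

    1≤n : 1 ≤ n
    1≤n = ≤-trans (s≤s z≤n) (Fin.toℕ<n (proj₁ candidate))

    1≤E : 1 ≤ degreeSum
    1≤E = ≤-trans 1≤n n≤E

    -- The degree sum is at least 1 and at least n, so it absorbs the constant and the linear term.
    linear≤ : ∀ a b → a + n * b ≤ (a + b) * degreeSum
    linear≤ a b = begin
      a + n * b                         ≤⟨ +-mono-≤ (m≤m*n a degreeSum {{>-nonZero 1≤E}}) (*-monoˡ-≤ b n≤E) ⟩
      a * degreeSum + degreeSum * b     ≡⟨ cong (a * degreeSum +_) (*-comm degreeSum b) ⟩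
      a * degreeSum + b * degreeSum     ≡⟨ *-distribʳ-+ degreeSum a b ⟨
      (a + b) * degreeSum               ∎
      where open ≤-Reasoning

    constant≤ : ∀ a b {x} → x ≤ b * (n * degreeSum) → a + x ≤ (a + b) * (n * degreeSum)
    constant≤ a b {x} x≤ = begin
      a + x                                        ≤⟨ +-mono-≤ (m≤m*n a _ {{>-nonZero (*-mono-≤ 1≤n 1≤E)}}) x≤ ⟩
      a * (n * degreeSum) + b * (n * degreeSum)    ≡⟨ *-distribʳ-+ (n * degreeSum) a b ⟨
      (a + b) * (n * degreeSum)                    ∎
      where open ≤-Reasoning

    loop≤ : ∀ b {k} → k ≤ n → 2 + k * (4 + b * degreeSum) ≤ (6 + b) * (n * degreeSum)
    loop≤ b {k} k≤n = constant≤ 2 (4 + b) (begin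
      k * (4 + b * degreeSum)                ≤⟨ *-mono-≤ k≤n (+-monoˡ-≤ _ (m≤m*n 4 degreeSum {{>-nonZero 1≤E}})) ⟩
      n * (4 * degreeSum + b * degreeSum)    ≡⟨ cong (n *_) (*-distribʳ-+ degreeSum 4 b) ⟨
      n * ((4 + b) * degreeSum)              ≡⟨ swap n (4 + b) degreeSum ⟩
      (4 + b) * (n * degreeSum)              ∎)
      where
      open ≤-Reasoning
      swap : ∀ x y z → x * (y * z) ≡ y * (x * z)
      swap = solve-∀

    bfs-spec : ∀ x s → Loaded s → var s vSource ≡ toℕ x →
      cost bfs s ≤ 144 * degreeSum × (∀ v → arr (run bfs s) aDist (toℕ v) ≡ suc (dist G v x))
    bfs-spec x s L src≡ = cost≤ , finished′
      where
      s₁ s₂ : State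
      s₁ = run clearDistances s
      s₂ = run startSearch s₁

      L₁ : Loaded s₁
      L₁ = loaded-run clearDistances _ L

      src₁≡ : var s₁ vSource ≡ toℕ x
      src₁≡ = trans (exec-var clearDistances _ s) src≡

      started : Searching x n (n * 56 + degreeSum * 45) s₂
      started = record
        { h = 0 ; left = degree ; h+k≡n = refl ; vH≡ = refl
        ; search = subst (λ a → Search x (arr s₁ aDist [ a ↦ 1 ]) (arr s₁ aQueue [ 0 ↦ a ]) 0 1) (sym src₁≡)
            (search-start x (arr s₁ aDist) (arr s₁ aQueue) (proj₂ (clearDistances-spec s L)))
        ; unserved = λ _ _ → refl
        ; paid = ≤-refl
        ; loaded = loaded-run startSearch _ L₁
        }

      body : Cmd
      body = fetchVertex ⨾ loop vK visitNeighbour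

      searched : cost (loop vC body) s₂ ≤ 2 + (n * 56 + degreeSum * 45) ×
        ∃ λ r → Searching x 0 r (run (loop vC body) s₂)
      searched = loop-credit vC body (Searching x) n (serve-spec x) _ s₂ (n≡ L₁) started

      finished′ : ∀ v → arr (run bfs s) aDist (toℕ v) ≡ suc (dist G v x)
      finished′ = let _ , σ = proj₂ searched in
        finished (Searching.search σ) (trans (sym (+-identityʳ _)) (Searching.h+k≡n σ))

      cost≤ : cost bfs s ≤ 144 * degreeSum
      cost≤ = begin
        cost clearDistances s + (23 + cost (loop vC body) s₂)
          ≤⟨ +-mono-≤ (proj₁ (clearDistances-spec s L)) (+-monoʳ-≤ 23 (proj₁ searched)) ⟩
        5 + n * 13 + (23 + (2 + (n * 56 + degreeSum * 45)))
          ≡⟨ arith n degreeSum ⟩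
        30 + n * 69 + 45 * degreeSum
          ≤⟨ +-monoˡ-≤ _ (linear≤ 30 69) ⟩
        99 * degreeSum + 45 * degreeSum
          ≡⟨ *-distribʳ-+ degreeSum 99 45 ⟨
        144 * degreeSum ∎
        where
        open ≤-Reasoning
        arith : ∀ n e → 5 + n * 13 + (23 + (2 + (n * 56 + e * 45))) ≡ 30 + n * 69 + 45 * e
        arith = solve-∀

    -- After the sites with index at least k have been considered, u has owner o
    -- at distance b-1; b = 0 encodes that there is no owner yet.
    Claimed : ℕ → ℕ → ℕ → Fin n → Set
    Claimed k b o u = (k ≡ suc q × b ≡ 0) ⊎ ∃ λ i → o ≡ toℕ i × b ≡ suc (dist G u (lookup S i)) ×
      (∀ j → k ≤ toℕ j → dist G u (lookup S i) ≤ dist G u (lookup S j)) ×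
      (∀ j → k ≤ toℕ j → j Fin.< i → dist G u (lookup S i) < dist G u (lookup S j))

    -- Choice of owners, one site at a time

    module _ {k : ℕ} (i : Fin (suc q)) (i≡k : toℕ i ≡ k) {b o : ℕ} (u : Fin n) where

      private
        split : (P : Fin (suc q) → Set) → P i → (∀ j → suc k ≤ toℕ j → P j) → ∀ j → k ≤ toℕ j → P j
        split P Pi rest j k≤j with m≤n⇒m<n∨m≡n k≤j
        ... | inj₁ k<j = rest j k<j
        ... | inj₂ k≡j with Fin.toℕ-injective (trans i≡k k≡j)
        ...   | refl = Pi

      -- With index k the newcomer precedes all sites considered before, so its strictness clause is
      -- vacuous and being no farther than the old owner suffices. If there is no old owner, no site
      -- has been considered.
      claimed-new : Claimed (suc k) b o u → b ≡ 0 ⊎ suc (dist G u (lookup S i)) ≤ b →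
        Claimed k (suc (dist G u (lookup S i))) k u
      claimed-new claimed b≡0⊎ = inj₂ (i , sym i≡k , refl ,
        split (λ j → dist G u (lookup S i) ≤ dist G u (lookup S j)) ≤-refl (nearest b≡0⊎ claimed) ,
        λ j k≤j j<i → contradiction (subst (toℕ j <_) i≡k j<i) (≤⇒≯ k≤j))
        where
        nearest : b ≡ 0 ⊎ suc (dist G u (lookup S i)) ≤ b → Claimed (suc k) b o u →
          ∀ j → suc k ≤ toℕ j → dist G u (lookup S i) ≤ dist G u (lookup S j)
        nearest _ (inj₁ (1+k≡ , _)) j k<j = contradiction (Fin.toℕ<n j) (≤⇒≯ (subst (_≤ toℕ j) 1+k≡ k<j))
        nearest (inj₁ refl) (inj₂ (_ , _ , () , _))
        nearest (inj₂ d≤b)  (inj₂ (_ , _ , refl , near , _)) j k<j = ≤-trans (s≤s⁻¹ d≤b) (near j k<j)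

      -- The old owner stays only if strictly nearer, which is what its strictness clause demands
      -- against the preceding site i.
      claimed-old : Claimed (suc k) b o u → b ≢ 0 → b < suc (dist G u (lookup S i)) → Claimed k b o u
      claimed-old (inj₁ (_ , b≡0)) b≢0 b<d = contradiction b≡0 b≢0
      claimed-old (inj₂ (i′ , o≡ , refl , near , first)) b≢0 b<d = inj₂ (i′ , o≡ , refl ,
        split (λ j → dist G u (lookup S i′) ≤ dist G u (lookup S j)) (<⇒≤ (s≤s⁻¹ b<d)) near ,
        split (λ j → j Fin.< i′ → dist G u (lookup S i′) < dist G u (lookup S j)) (λ _ → s≤s⁻¹ b<d) first)

    -- The situation within the pass for site i: vertices below k still refer to the sites after i,
    -- the others already to the sites from i on.
    record Comparing (i : Fin (suc q)) (k : ℕ) (s : State) : Set c where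
      field
        vI≡   : var s vI ≡ toℕ i
        dist≡ : ∀ v → arr s aDist (toℕ v) ≡ suc (dist G v (lookup S i))
        old   : ∀ v → toℕ v < k → Claimed (suc (toℕ i)) (arr s aBest (toℕ v)) (arr s aOwner (toℕ v)) v
        new   : ∀ v → k ≤ toℕ v → Claimed (toℕ i) (arr s aBest (toℕ v)) (arr s aOwner (toℕ v)) v

    compareSite-spec : ∀ i k s → k < n → Comparing i (suc k) s →
      cost compareSite (setVar vU k s) ≤ 59 × Comparing i k (run compareSite (setVar vU k s))
    -- 59 is the exact value of `cost`, with both branches charged.
    compareSite-spec i k s k<n M = ≤-refl ,
      ifPositive-elim (Comparing i k) vZ (ifPositive vDU skip claim) claim s₁
        (λ b≢0 → ifPositive-elim (Comparing i k) vDU skip claim s₁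
          (λ d≰b → keep b≢0 (≰⇒> λ d≤b → d≰b (m≤n⇒m∸n≡0 (≤-trans (≤-reflexive d≡) d≤b))))
          (λ d≤b → change (inj₂ (≤-trans (≤-reflexive (sym d≡)) (m∸n≡0⇒m≤n d≤b)))))
        (λ b≡0 → change (inj₁ b≡0))
      where
      open Comparing M
      u : Fin n
      u = fromℕ< k<n
      u≡k : toℕ u ≡ k
      u≡k = Fin.toℕ-fromℕ< k<n
      s₁ : State
      s₁ = run (op (get vX aDist vU) ⨾ op (get vZ aBest vU) ⨾ op (minus vDU vX vZ)) (setVar vU k s)

      d : ℕ
      d = suc (dist G u (lookup S i))
      d≡ : arr s aDist k ≡ d
      d≡ = trans (cong (arr s aDist) (sym u≡k)) (dist≡ u)

      claimed : Claimed (suc (toℕ i)) (arr s aBest k) (arr s aOwner k) u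
      claimed = subst (λ x → Claimed (suc (toℕ i)) (arr s aBest x) (arr s aOwner x) u) u≡k
        (old u (subst (_< suc k) (sym u≡k) ≤-refl))

      -- Both outcomes change the two arrays at most at k, so the step is proved once for arbitrary
      -- arrays that agree with the old ones elsewhere.
      extend : ∀ {best owner} → Claimed (toℕ i) (best k) (owner k) u →
        (∀ x → x ≢ k → best x ≡ arr s aBest x) → (∀ x → x ≢ k → owner x ≡ arr s aOwner x) →
        (∀ v → toℕ v < k → Claimed (suc (toℕ i)) (best (toℕ v)) (owner (toℕ v)) v) ×
        (∀ v → k ≤ toℕ v → Claimed (toℕ i) (best (toℕ v)) (owner (toℕ v)) v)
      extend {best} {owner} here best≡ owner≡ = below , above
        where
        below : ∀ v → toℕ v < k → Claimed (suc (toℕ i)) (best (toℕ v)) (owner (toℕ v)) v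
        below v v<k = subst₂ (λ b o → Claimed (suc (toℕ i)) b o v)
          (sym (best≡ _ (<⇒≢ v<k))) (sym (owner≡ _ (<⇒≢ v<k))) (old v (m<n⇒m<1+n v<k))
        above : ∀ v → k ≤ toℕ v → Claimed (toℕ i) (best (toℕ v)) (owner (toℕ v)) v
        above v k≤v with m≤n⇒m<n∨m≡n k≤v
        ... | inj₁ k<v = subst₂ (λ b o → Claimed (toℕ i) b o v)
          (sym (best≡ _ (<⇒≢ k<v ∘ sym))) (sym (owner≡ _ (<⇒≢ k<v ∘ sym))) (new v k<v)
        ... | inj₂ k≡v with Fin.toℕ-injective (trans u≡k k≡v)
        ...   | refl = subst (λ x → Claimed (toℕ i) (best x) (owner x) u) k≡v here

      keep : arr s aBest k ≢ 0 → arr s aBest k < d → Comparing i k s₁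
      keep b≢0 b<d with extend {arr s aBest} {arr s aOwner}
        (claimed-old i refl u claimed b≢0 b<d) (λ _ _ → refl) (λ _ _ → refl)
      ... | below , above = record { vI≡ = vI≡ ; dist≡ = dist≡ ; old = below ; new = above }

      change : arr s aBest k ≡ 0 ⊎ d ≤ arr s aBest k → Comparing i k (run claim s₁)
      change b with extend {arr s aBest [ k ↦ arr s aDist k ]} {arr s aOwner [ k ↦ var s vI ]}
        (subst₂ (λ b o → Claimed (toℕ i) b o u)
          (sym (trans (update-same (arr s aBest) k _) d≡)) (sym (trans (update-same (arr s aOwner) k _) vI≡))
          (claimed-new i refl u claimed b))
        (λ x x≢k → update-other (arr s aBest) _ x≢k) (λ x x≢k → update-other (arr s aOwner) _ x≢k)
      ... | below , above = record { vI≡ = vI≡ ; dist≡ = dist≡ ; old = below ; new = above }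

    ClaimedAll : ℕ → State → Set
    ClaimedAll k s = ∀ v → Claimed k (arr s aBest (toℕ v)) (arr s aOwner (toℕ v)) v

    addSite-spec : ∀ k s → k < suc q → Loaded s × ClaimedAll (suc k) s →
      cost addSite (setVar vI k s) ≤ 220 * degreeSum ×
      Loaded (run addSite (setVar vI k s)) × ClaimedAll k (run addSite (setVar vI k s))
    addSite-spec k s k<p (L , old) = cost≤ , loaded-run addSite _ L₀ , λ v →
      subst (λ k → Claimed k (arr s₄ aBest (toℕ v)) (arr s₄ aOwner (toℕ v)) v) i≡k
        (Comparing.new (proj₂ compared) v z≤n)
      where
      i : Fin (suc q)
      i = fromℕ< k<p
      i≡k : toℕ i ≡ k
      i≡k = Fin.toℕ-fromℕ< k<p

      s₀ s₁ s₂ s₃ s₄ : State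
      s₀ = setVar vI k s
      s₁ = run (op (get vSource aNbr vI)) s₀
      s₂ = run bfs s₁
      s₃ = run (op (mov vU vN)) s₂
      s₄ = run (loop vU compareSite) s₃

      L₀ : Loaded s₀
      L₀ = loaded-setVar vI k _ L
      L₁ : Loaded s₁
      L₁ = loaded-run (op (get vSource aNbr vI)) _ L₀
      L₂ : Loaded s₂
      L₂ = loaded-run bfs _ L₁

      searched : cost bfs s₁ ≤ 144 * degreeSum × (∀ v → arr s₂ aDist (toℕ v) ≡ suc (dist G v (lookup S i)))
      searched = bfs-spec (lookup S i) s₁ L₁ (trans (cong (arr s aNbr) (sym i≡k)) (members L i))

      old₂ : ∀ v → Claimed (suc (toℕ i)) (arr s₂ aBest (toℕ v)) (arr s₂ aOwner (toℕ v)) v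
      old₂ v = subst₂ (λ best owner → Claimed (suc (toℕ i)) (best (toℕ v)) (owner (toℕ v)) v)
        (sym (exec-arr bfs _ s₁)) (sym (exec-arr bfs _ s₁))
        (subst (λ k → Claimed (suc k) (arr s aBest (toℕ v)) (arr s aOwner (toℕ v)) v) (sym i≡k) (old v))

      compared : cost (loop vU compareSite) s₃ ≤ 2 + n * 63 × Comparing i 0 s₄
      compared = loop-invariant vU compareSite (Comparing i) 59 n (compareSite-spec i) s₃ (n≡ L₂) record
          { vI≡ = trans (exec-var bfs _ s₁) (sym i≡k)
          ; dist≡ = proj₂ searched
          ; old = λ v _ → old₂ v
          ; new = λ v n≤v → contradiction (Fin.toℕ<n v) (≤⇒≯ n≤v)
          }

      cost≤ : cost addSite s₀ ≤ 220 * degreeSum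
      cost≤ = begin
        9 + (cost bfs s₁ + (2 + cost (loop vU compareSite) s₃))
          ≤⟨ +-monoʳ-≤ 9 (+-mono-≤ (proj₁ searched) (+-monoʳ-≤ 2 (proj₁ compared))) ⟩
        9 + (144 * degreeSum + (2 + (2 + n * 63)))
          ≡⟨ arith n degreeSum ⟩
        13 + n * 63 + 144 * degreeSum
          ≤⟨ +-monoˡ-≤ _ (linear≤ 13 63) ⟩
        76 * degreeSum + 144 * degreeSum
          ≡⟨ *-distribʳ-+ degreeSum 76 144 ⟨
        220 * degreeSum ∎
        where
        open ≤-Reasoning
        arith : ∀ n e → 9 + (144 * e + (2 + (2 + n * 63))) ≡ 13 + n * 63 + 144 * e
        arith = solve-∀

    record OwnedBy (owner : Fin n → Fin (suc q)) (s : State) : Set where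
      field
        owner≡ : ∀ u → arr s aOwner (toℕ u) ≡ toℕ (owner u)
        best≡  : ∀ u → arr s aBest (toℕ u) ≡ suc (dist G u (lookup S (owner u)))

    ownedBy-run : ∀ C → KeepsArr aBest C × KeepsArr aOwner C → ∀ {owner s} → OwnedBy owner s → OwnedBy owner (run C s)
    ownedBy-run C (kb , ko) {s = s} O = record
      { owner≡ = λ u → trans (cong (λ f → f (toℕ u)) (exec-arr C ko s)) (OwnedBy.owner≡ O u)
      ; best≡  = λ u → trans (cong (λ f → f (toℕ u)) (exec-arr C kb s)) (OwnedBy.best≡ O u)
      }

    p≤n : suc q ≤ n
    p≤n = Fin.injective⇒≤ λ {i} {j} → lookup-injective proper i j

    chooseOwners-spec : ∀ s → Loaded s → (∀ i → arr s aBest i ≡ 0) →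
      cost chooseOwners s ≤ 228 * (n * degreeSum) ×
      ∃ λ owner → (∀ u → Owns S (owner u) u) × OwnedBy owner (run chooseOwners s)
    chooseOwners-spec s L empty = cost≤ , (λ u → proj₁ (claim-of u)) ,
      (λ u → let near , first = proj₂ (proj₂ (proj₂ (claim-of u))) in (λ j → near j z≤n) , λ j → first j z≤n) , record
      { owner≡ = λ u → proj₁ (proj₂ (claim-of u))
      ; best≡ = λ u → proj₁ (proj₂ (proj₂ (claim-of u)))
      }
      where
      s₁ s₂ : State
      s₁ = run (op (mov vI vP)) s
      s₂ = run chooseOwners s

      added : cost (loop vI addSite) s₁ ≤ 2 + suc q * (4 + 220 * degreeSum) × Loaded s₂ × ClaimedAll 0 s₂
      added = loop-invariant vI addSite (λ k s → Loaded s × ClaimedAll k s) (220 * degreeSum) (suc q)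
        addSite-spec s₁ (p≡ L) (loaded-run (op (mov vI vP)) _ L , λ v → inj₁ (refl , empty (toℕ v)))

      claim-of : ∀ u → ∃ λ i → arr s₂ aOwner (toℕ u) ≡ toℕ i × arr s₂ aBest (toℕ u) ≡ suc (dist G u (lookup S i)) ×
        (∀ j → 0 ≤ toℕ j → dist G u (lookup S i) ≤ dist G u (lookup S j)) ×
        (∀ j → 0 ≤ toℕ j → j Fin.< i → dist G u (lookup S i) < dist G u (lookup S j))
      claim-of u with proj₂ (proj₂ added) u
      -- Having no owner would mean 0 = q + 1 here.
      ... | inj₂ claimed = claimed

      cost≤ : cost chooseOwners s ≤ 228 * (n * degreeSum)
      cost≤ = constant≤ 2 226 (≤-trans (proj₁ added) (loop≤ 220 p≤n))

    -- Loads after the addition of a site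

    open OrderedField R using (_≈_; totalOrder; decTotalOrder; +-commutativeMonoid)
    open Bundles.DecTotalOrder decTotalOrder using ()
      renaming (refl to ≤ᶠ-refl; reflexive to ≤ᶠ-reflexive; trans to ≤ᶠ-trans; total to ≤ᶠ-total)
    open CommutativeMonoid +-commutativeMonoid using ()
      renaming (refl to ≈-refl; sym to ≈-sym; trans to ≈-trans; reflexive to ≈-reflexive;
                ∙-cong to +ᶠ-cong; identityʳ to +ᶠ-identityʳ)
    open Sum +-commutativeMonoid using ()
      renaming (sum to sumᶠ; sum-cong-≗ to sumᶠ-cong; sum-replicate-zero to sumᶠ-zero)
    open Maximum totalOrder

    -- The summands with index at least k.
    from : ∀ {n} → ℕ → (Fin n → Carrier) → Fin n → Carrier
    from k f v = if k ≤ᵇ toℕ v then f v else 0#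

    from-≤ : ∀ {n k} (f : Fin n → Carrier) v → k ≤ toℕ v → from k f v ≡ f v
    from-≤ {k = k} f v k≤v with k ≤ᵇ toℕ v | ≤⇒≤ᵇ k≤v
    ... | true | _ = refl

    from-> : ∀ {n k} (f : Fin n → Carrier) v → toℕ v < k → from k f v ≡ 0#
    from-> {k = k} f v v<k with k ≤ᵇ toℕ v | ≤ᵇ⇒≤ k (toℕ v)
    ... | true  | k≤v = contradiction v<k (≤⇒≯ (k≤v tt))
    ... | false | _   = refl

    -- The two sums differ only at u, where one term is `f u` and the other zero, so `sum-replace`
    -- applies.
    sum-from-suc : ∀ {n} k (f : Fin n → Carrier) u → toℕ u ≡ k → sumᶠ (from k f) ≈ sumᶠ (from (suc k) f) +ᶠ f u
    sum-from-suc k f u refl = ≈-trans (≈-sym (+ᶠ-identityʳ _)) (≈-trans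
      (+ᶠ-cong ≈-refl (≈-reflexive (sym (from-> f u ≤-refl))))
      (≈-trans (sum-replace +-commutativeMonoid (from k f) (from (suc k) f) u λ v v≢u → ≈-reflexive (same v v≢u))
        (+ᶠ-cong ≈-refl (≈-reflexive (from-≤ f u ≤-refl)))))
      where
      same : ∀ v → v ≢ u → from k f v ≡ from (suc k) f v
      same v v≢u with toℕ v <? k
      ... | yes v<k = trans (from-> f v v<k) (sym (from-> f v (m<n⇒m<1+n v<k)))
      ... | no v≮k  = trans (from-≤ f v (≮⇒≥ v≮k))
        (sym (from-≤ f v (≤∧≢⇒< (≮⇒≥ v≮k) λ k≡v → v≢u (Fin.toℕ-injective (sym k≡v)))))

    sum-from-all : ∀ {n} (f : Fin n → Carrier) → sumᶠ (from n f) ≈ 0#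
    sum-from-all {n} f = ≈-trans (≈-reflexive (sumᶠ-cong λ v → from-> f v (Fin.toℕ<n v))) (sumᶠ-zero n)

    clearLoads-spec : ∀ s → var s vP ≡ suc q →
      cost clearLoads s ≤ 7 + (1 + n) * 13 × (∀ i → i < suc (suc q) → farr (run clearLoads s) aLoad i ≡ 0#)
    clearLoads-spec s p≡ = ≤-trans (+-monoʳ-≤ 5 (proj₁ spec)) (+-monoʳ-≤ 7 (*-monoˡ-≤ 13 (s≤s p≤n))) ,
      λ i → proj₂ (proj₂ spec) i z≤n
      where
      Cleared : ℕ → State → Set c
      Cleared k s = fvar s fY ≡ 0# × (∀ i → k ≤ i → i < suc (suc q) → farr s aLoad i ≡ 0#)

      clear : ∀ k s → k < suc (suc q) → Cleared (suc k) s →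
        9 ≤ 9 × Cleared k (run (op (putF aLoad vI fY)) (setVar vI k s))
      clear k s _ (y≡0 , cleared) = ≤-refl , y≡0 , at
        where
        at : ∀ i → k ≤ i → i < suc (suc q) → (farr s aLoad [ k ↦ fvar s fY ]) i ≡ 0#
        at i k≤i i< with i ≟ k
        ... | yes refl = trans (update-same (farr s aLoad) k _) y≡0
        ... | no  i≢k  = trans (update-other (farr s aLoad) _ i≢k) (cleared i (≤∧≢⇒< k≤i (i≢k ∘ sym)) i<)

      spec = loop-invariant vI (op (putF aLoad vI fY)) Cleared 9 (suc (suc q)) clear
        (run (op (zeroF fY) ⨾ op (mov vI vP) ⨾ op (inc vI)) s) (cong suc p≡)
        (refl , λ i p≤i i<p → contradiction i<p (≤⇒≯ p≤i))

    module _ (w : Fin n) (owner : Fin n → Fin (suc q)) (owns : ∀ u → Owns S (owner u) u) where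

      newOwner : Fin n → Fin (suc (suc q))
      newOwner u = if does (dist G u w <? dist G u (lookup S (owner u))) then fromℕ (suc q) else inject₁ (owner u)

      newOwner-new : ∀ {u} → dist G u w < dist G u (lookup S (owner u)) → newOwner u ≡ fromℕ (suc q)
      newOwner-new {u} d< with dist G u w <ᵇ dist G u (lookup S (owner u)) | <⇒<ᵇ d<
      ... | true | _ = refl

      newOwner-old : ∀ {u} → dist G u (lookup S (owner u)) ≤ dist G u w → newOwner u ≡ inject₁ (owner u)
      newOwner-old {u} d≤
        with dist G u w <ᵇ dist G u (lookup S (owner u))
           | <ᵇ⇒< (dist G u w) (dist G u (lookup S (owner u)))
      ... | true  | d< = contradiction (d< tt) (≤⇒≯ d≤)
      ... | false | _  = refl

      newOwner-owns : ∀ u → Owns (S ∷ʳ w) (newOwner u) u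
      newOwner-owns u with dist G u w <? dist G u (lookup S (owner u))
      ... | yes d< = subst (λ o → Owns (S ∷ʳ w) o u) (sym (newOwner-new d<)) (owns-new S w (owns u) d<)
      ... | no d≮  = subst (λ o → Owns (S ∷ʳ w) o u) (sym (newOwner-old (≮⇒≥ d≮))) (owns-old S w (owns u) (≮⇒≥ d≮))

      share : Fin (suc (suc q)) → Fin n → Carrier
      share i v = if does (newOwner v Fin.≟ i) then π v else 0#

      load≡ : ∀ i → load R G π (S ∷ʳ w) i ≡ sumᶠ (share i)
      load≡ i = sumᶠ-cong λ v → cong (λ b → if b then π v else 0#) (does-inTerritory? {S = S ∷ʳ w} (newOwner-owns v) i)

      -- The loop descends, so the cells hold partial sums over the vertices from k on. They match
      -- only up to `≈`, because `sum` adds the terms in another order.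
      record Adding (k : ℕ) (s : State) : Set (c Level.⊔ ℓ₁) where
        field
          loaded : Loaded s
          owned  : OwnedBy owner s
          dist≡  : ∀ v → arr s aDist (toℕ v) ≡ suc (dist G v w)
          load≈  : ∀ i → farr s aLoad (toℕ i) ≈ sumᶠ (from k (share i))

      addBody : Cmd
      addBody = locate ⨾ ifPositive vZ (op (mov vX vP)) (op (get vX aOwner vU)) ⨾ addCost

      addBody-spec : ∀ k s → k < n → Adding (suc k) s →
        cost addBody (setVar vU k s) ≤ 60 × Adding k (run addBody (setVar vU k s))
      addBody-spec k s k<n σ = ≤-refl , record
        { loaded = loaded-run addBody _ (loaded-setVar vU k _ loaded)
        ; owned = ownedBy-run addBody _ {s = setVar vU k s} (record { OwnedBy owned })
        ; dist≡ = λ v → trans (cong (λ f → f (toℕ v)) (exec-arr addBody _ (setVar vU k s))) (dist≡ v)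
        ; load≈ = ifPositive-elim (λ s′ → ∀ i → farr (run addCost s′) aLoad (toℕ i) ≈ sumᶠ (from k (share i)))
            vZ (op (mov vX vP)) (op (get vX aOwner vU)) s₁
            (λ d< → added (run (op (mov vX vP)) s₁) refl refl refl (trans (p≡ loaded)
              (trans (sym (Fin.toℕ-fromℕ (suc q))) (cong toℕ (sym (newOwner-new (closer d<)))))))
            (λ d≥ → added (run (op (get vX aOwner vU)) s₁) refl refl refl
              (trans (cong (arr s aOwner) (sym u≡k)) (trans (OwnedBy.owner≡ owned u)
                (trans (sym (Fin.toℕ-inject₁ (owner u))) (cong toℕ (sym (newOwner-old (farther d≥))))))))
        }
        where
        open Adding σ
        u : Fin n
        u = fromℕ< k<n
        u≡k : toℕ u ≡ k
        u≡k = Fin.toℕ-fromℕ< k<n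
        s₁ : State
        s₁ = run locate (setVar vU k s)

        vZ≡ : var s₁ vZ ≡ dist G u (lookup S (owner u)) ∸ dist G u w
        vZ≡ = cong₂ _∸_ (trans (cong (arr s aBest) (sym u≡k)) (OwnedBy.best≡ owned u))
                        (trans (cong (arr s aDist) (sym u≡k)) (dist≡ u))

        closer : var s₁ vZ ≢ 0 → dist G u w < dist G u (lookup S (owner u))
        closer z≢0 = ≰⇒> λ d≤ → z≢0 (trans vZ≡ (m≤n⇒m∸n≡0 d≤))

        farther : var s₁ vZ ≡ 0 → dist G u (lookup S (owner u)) ≤ dist G u w
        farther z≡0 = m∸n≡0⇒m≤n (trans (sym vZ≡) z≡0)

        added : ∀ s′ → var s′ vU ≡ k → farr s′ aLoad ≡ farr s aLoad → farr s′ aCost ≡ farr s aCost →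
          var s′ vX ≡ toℕ (newOwner u) → ∀ i → farr (run addCost s′) aLoad (toℕ i) ≈ sumᶠ (from k (share i))
        added s′ refl load≡′ cost≡ x≡ i with newOwner u Fin.≟ i in eq
        ... | yes o≡i = ≈-trans (≈-reflexive (trans
              (cong (λ x → (farr s′ aLoad [ x ↦ farr s′ aLoad x +ᶠ farr s′ aCost k ]) (toℕ i)) (trans x≡ (cong toℕ o≡i)))
              (trans (update-same (farr s′ aLoad) (toℕ i) _)
                (cong₂ _+ᶠ_ (cong (λ f → f (toℕ i)) load≡′) (trans (cong (λ f → f k) cost≡)
                  (trans (cong (farr s aCost) (sym u≡k)) (trans (costs loaded u) (sym share≡))))))))
            (≈-trans (+ᶠ-cong (load≈ i) ≈-refl) (≈-sym (sum-from-suc k (share i) u u≡k)))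
          where
          share≡ : share i u ≡ π u
          share≡ = cong (λ d → if does d then π u else 0#) eq
        ... | no o≢i = ≈-trans (≈-reflexive (trans
              (update-other (farr s′ aLoad) _ λ i≡x → o≢i (sym (Fin.toℕ-injective (trans i≡x x≡))))
              (cong (λ f → f (toℕ i)) load≡′)))
            (≈-trans (load≈ i) (≈-trans (≈-sym (+ᶠ-identityʳ _))
              (≈-trans (+ᶠ-cong ≈-refl (≈-reflexive (sym share≡))) (≈-sym (sum-from-suc k (share i) u u≡k)))))
          where
          share≡ : share i u ≡ 0#
          share≡ = cong (λ d → if does d then π u else 0#) eq

      addCosts-spec : ∀ s → Loaded s → OwnedBy owner s → (∀ v → arr s aDist (toℕ v) ≡ suc (dist G v w)) →
        (∀ i → i < suc (suc q) → farr s aLoad i ≡ 0#) →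
        cost addCosts s ≤ 4 + n * 64 × (∀ i → farr (run addCosts s) aLoad (toℕ i) ≈ load R G π (S ∷ʳ w) i)
      addCosts-spec s L O d≡ load≡0 = +-monoʳ-≤ 2 (proj₁ spec) ,
        λ i → ≈-trans (Adding.load≈ (proj₂ spec) i) (≈-reflexive (sym (load≡ i)))
        where
        s₁ : State
        s₁ = run (op (mov vU vN)) s

        spec : cost (loop vU addBody) s₁ ≤ 2 + n * 64 × Adding 0 (run (loop vU addBody) s₁)
        spec = loop-invariant vU addBody Adding 60 n addBody-spec s₁ (n≡ L) record
          { loaded = loaded-run (op (mov vU vN)) _ L
          ; owned = record { OwnedBy O }
          ; dist≡ = d≡
          ; load≈ = λ i → ≈-trans (≈-reflexive (load≡0 (toℕ i) (Fin.toℕ<n i))) (≈-sym (sum-from-all (share i)))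
          }

    -- Being a bound and being attained characterise a maximum independently of the sequence of
    -- comparisons, which here runs downwards from the last load.
    record Largest (L : ℕ → Carrier) (k : ℕ) (x : Carrier) : Set (c Level.⊔ ℓ₂) where
      field
        bound    : ∀ (i : Fin (suc (suc q))) → k ≤ toℕ i → L (toℕ i) ≤ᶠ x
        attained : ∃ λ (i : Fin (suc (suc q))) → x ≡ L (toℕ i)

    maximise-spec : ∀ s → var s vP ≡ suc q →
      cost maximise s ≤ 13 + n * 17 × Largest (farr s aLoad) 0 (fvar (run maximise s) fMax)
    maximise-spec s p≡ = ≤-trans (+-monoʳ-≤ 11 (proj₁ spec)) (+-monoʳ-≤ 13 (*-monoˡ-≤ 17 p≤n)) , proj₂ (proj₂ spec)
      where
      Inv : ℕ → State → Set (c Level.⊔ ℓ₂)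
      Inv k s′ = farr s′ aLoad ≡ farr s aLoad × Largest (farr s aLoad) k (fvar s′ fMax)

      body : ∀ k s′ → k < suc q → Inv (suc k) s′ →
        cost takeLarger (setVar vI k s′) ≤ 13 × Inv k (run takeLarger (setVar vI k s′))
      body k s′ k<p (L≡ , M) = ≤-refl , ifLeqF-elim (Inv k) fY fMax skip (op (movF fMax fY)) s₁
        (λ y≤ → L≡ , record { bound = extend y≤ (Largest.bound M) ; attained = Largest.attained M })
        (λ y≰ → L≡ , record
          { bound = extend ≤ᶠ-refl λ i k<i → ≤ᶠ-trans (Largest.bound M i k<i) (flip y≰)
          ; attained = u , y≡ })
        where
        s₁ : State
        s₁ = run (op (getF fY aLoad vI)) (setVar vI k s′)
        u : Fin (suc (suc q))
        u = fromℕ< (m<n⇒m<1+n k<p)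
        u≡k : toℕ u ≡ k
        u≡k = Fin.toℕ-fromℕ< (m<n⇒m<1+n k<p)
        y≡ : fvar s₁ fY ≡ farr s aLoad (toℕ u)
        y≡ = trans (cong (λ f → f k) L≡) (cong (farr s aLoad) (sym u≡k))

        flip : ¬ (fvar s₁ fY ≤ᶠ fvar s₁ fMax) → fvar s₁ fMax ≤ᶠ fvar s₁ fY
        flip y≰ with ≤ᶠ-total (fvar s₁ fMax) (fvar s₁ fY)
        ... | inj₁ ≤y = ≤y
        ... | inj₂ y≤ = contradiction y≤ y≰

        extend : ∀ {x} → fvar s₁ fY ≤ᶠ x → (∀ (i : Fin (suc (suc q))) → suc k ≤ toℕ i → farr s aLoad (toℕ i) ≤ᶠ x) →
          ∀ (i : Fin (suc (suc q))) → k ≤ toℕ i → farr s aLoad (toℕ i) ≤ᶠ x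
        extend y≤x rest i k≤i with m≤n⇒m<n∨m≡n k≤i
        ... | inj₁ k<i = rest i k<i
        ... | inj₂ k≡i with Fin.toℕ-injective (trans u≡k k≡i)
        ...   | refl = subst (_≤ᶠ _) y≡ y≤x

      s₀ : State
      s₀ = run (op (getF fMax aLoad vP) ⨾ op (mov vI vP)) s

      last : Fin (suc (suc q))
      last = fromℕ (suc q)

      M≡ : fvar s₀ fMax ≡ farr s aLoad (toℕ last)
      M≡ = cong (farr s aLoad) (trans p≡ (sym (Fin.toℕ-fromℕ (suc q))))

      spec : cost (loop vI takeLarger) s₀ ≤ 2 + suc q * 17 × Inv 0 (run (loop vI takeLarger) s₀)
      spec = loop-invariant vI takeLarger Inv 13 (suc q) body s₀ p≡ (refl , record
        { bound = λ i p≤i → ≤ᶠ-reflexive (≈-reflexive (trans (cong (farr s aLoad)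
            (trans (≤-antisym (s≤s⁻¹ (Fin.toℕ<n i)) p≤i) (sym (Fin.toℕ-fromℕ (suc q))))) (sym M≡)))
        ; attained = last , M≡ })

    -- Two inequalities instead of an equation: the computed loads are known up to `≈` only, and the
    -- choice of the best vertex just compares values.
    evaluate-spec : ∀ w owner → (∀ u → Owns S (owner u) u) → ∀ s → Loaded s → OwnedBy owner s →
      (∀ v → arr s aDist (toℕ v) ≡ suc (dist G v w)) →
      cost evaluate s ≤ 131 * degreeSum ×
      fvar (run evaluate s) fMax ≤ᶠ maxLoad R G π (S ∷ʳ w) × maxLoad R G π (S ∷ʳ w) ≤ᶠ fvar (run evaluate s) fMax
    evaluate-spec w owner owns s L O d≡ = cost≤ ,
      subst (_≤ᶠ maxLoad R G π (S ∷ʳ w)) (sym (proj₂ (Largest.attained (proj₂ maximised))))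
        (≤ᶠ-trans (≤ᶠ-reflexive (proj₂ added (proj₁ (Largest.attained (proj₂ maximised)))))
          (≤maximum (load R G π (S ∷ʳ w)) _)) ,
      maximum≤ (load R G π (S ∷ʳ w)) λ i →
        ≤ᶠ-trans (≤ᶠ-reflexive (≈-sym (proj₂ added i))) (Largest.bound (proj₂ maximised) i z≤n)
      where
      s₁ s₂ : State
      s₁ = run clearLoads s
      s₂ = run addCosts s₁
      L₁ : Loaded s₁
      L₁ = loaded-run clearLoads _ L
      cleared = clearLoads-spec s (p≡ L)
      added = addCosts-spec w owner owns s₁ L₁ (ownedBy-run clearLoads _ O)
        (λ v → trans (cong (λ f → f (toℕ v)) (exec-arr clearLoads _ s)) (d≡ v)) (proj₂ cleared)
      maximised = maximise-spec s₂ (p≡ (loaded-run addCosts _ L₁))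

      cost≤ : cost evaluate s ≤ 131 * degreeSum
      cost≤ = begin
        cost clearLoads s + (cost addCosts s₁ + cost maximise s₂)
          ≤⟨ +-mono-≤ (proj₁ cleared) (+-mono-≤ (proj₁ added) (proj₁ maximised)) ⟩
        7 + (1 + n) * 13 + (4 + n * 64 + (13 + n * 17))
          ≡⟨ arith n ⟩
        37 + n * 94
          ≤⟨ linear≤ 37 94 ⟩
        131 * degreeSum ∎
        where
        open ≤-Reasoning
        arith : ∀ n → 7 + (1 + n) * 13 + (4 + n * 64 + (13 + n * 17)) ≡ 37 + n * 94
        arith = solve-∀

    -- The best candidate with index at least k, if vFound = f is positive, is vAnswer = a.
    Best : ℕ → ℕ → ℕ → Carrier → Set ℓ₂
    Best k f a x =
      Level.Lift ℓ₂ (f ≡ 0 × ∀ v → k ≤ toℕ v → ¬ v ∉ᵛ S) ⊎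
      (f ≢ 0 × ∃ λ v → a ≡ toℕ v × v ∉ᵛ S × x ≤ᶠ maxLoad R G π (S ∷ʳ v) × maxLoad R G π (S ∷ʳ v) ≤ᶠ x ×
        (∀ u → k ≤ toℕ u → u ∉ᵛ S → maxLoad R G π (S ∷ʳ v) ≤ᶠ maxLoad R G π (S ∷ʳ u)))

    -- Updating the best candidate

    module _ {k : ℕ} (w : Fin n) (w≡k : toℕ w ≡ k) where

      private
        split : ∀ {p} (P : Fin n → Set p) → P w → (∀ u → suc k ≤ toℕ u → P u) → ∀ u → k ≤ toℕ u → P u
        split P Pw rest u k≤u with m≤n⇒m<n∨m≡n k≤u
        ... | inj₁ k<u = rest u k<u
        ... | inj₂ k≡u with Fin.toℕ-injective (trans w≡k k≡u)
        ...   | refl = Pw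

      best-member : ∀ {f a x} → ¬ w ∉ᵛ S → Best (suc k) f a x → Best k f a x
      best-member w∈ (inj₁ (Level.lift (f≡0 , none))) = inj₁ (Level.lift (f≡0 , split (λ v → ¬ v ∉ᵛ S) w∈ none))
      best-member w∈ (inj₂ (f≢0 , v , a≡ , v∉ , x≤ , ≤x , min)) = inj₂ (f≢0 , v , a≡ , v∉ , x≤ , ≤x ,
        split (λ u → u ∉ᵛ S → maxLoad R G π (S ∷ʳ v) ≤ᶠ maxLoad R G π (S ∷ʳ u)) (λ w∉ → contradiction w∉ w∈) min)

      module _ {y : Carrier} (y≤ : y ≤ᶠ maxLoad R G π (S ∷ʳ w)) (≤y : maxLoad R G π (S ∷ʳ w) ≤ᶠ y) where

        best-keep : ∀ {f a x} → f ≢ 0 → x ≤ᶠ y → Best (suc k) f a x → Best k f a x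
        best-keep f≢0 x≤y (inj₁ (Level.lift (f≡0 , _))) = contradiction f≡0 f≢0
        best-keep _ x≤y (inj₂ (f≢0 , v , a≡ , v∉ , x≤ , ≤x , min)) = inj₂ (f≢0 , v , a≡ , v∉ , x≤ , ≤x ,
          split (λ u → u ∉ᵛ S → maxLoad R G π (S ∷ʳ v) ≤ᶠ maxLoad R G π (S ∷ʳ u))
            (λ _ → ≤ᶠ-trans ≤x (≤ᶠ-trans x≤y y≤)) min)

        best-replace : ∀ {f a x} → w ∉ᵛ S → f ≡ 0 ⊎ y ≤ᶠ x → Best (suc k) f a x → Best k 1 k y
        best-replace {f} {a} {x} w∉ f≡0⊎y≤x best = inj₂ ((λ ()) , w , sym w≡k , w∉ , y≤ , ≤y ,
          split (λ u → u ∉ᵛ S → maxLoad R G π (S ∷ʳ w) ≤ᶠ maxLoad R G π (S ∷ʳ u)) (λ _ → ≤ᶠ-refl)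
            (minimal f≡0⊎y≤x best))
          where
          minimal : f ≡ 0 ⊎ y ≤ᶠ x → Best (suc k) f a x →
            ∀ u → suc k ≤ toℕ u → u ∉ᵛ S → maxLoad R G π (S ∷ʳ w) ≤ᶠ maxLoad R G π (S ∷ʳ u)
          minimal _ (inj₁ (Level.lift (_ , none))) u k<u u∉ = contradiction u∉ (none u k<u)
          minimal (inj₁ f≡0) (inj₂ (f≢0 , _)) = contradiction f≡0 f≢0
          minimal (inj₂ y≤x) (inj₂ (_ , v , _ , _ , x≤ , _ , min)) u k<u u∉ =
            -- The computed values y for w and x for the previous best v link the two maximum loads,
            -- and v was minimal among the candidates above k.
            ≤ᶠ-trans ≤y (≤ᶠ-trans y≤x (≤ᶠ-trans x≤ (min u k<u u∉)))

    module _ (owner : Fin n → Fin (suc q)) (owns : ∀ u → Owns S (owner u) u) where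

      record Trying (k : ℕ) (s : State) : Set (c Level.⊔ ℓ₂) where
        field
          loaded : Loaded s
          owned  : OwnedBy owner s
          best   : Best k (var s vFound) (var s vAnswer) (fvar s fBest)

      tryVertex-spec : ∀ k s → k < n → Trying (suc k) s →
        cost tryVertex (setVar vW k s) ≤ 304 * degreeSum × Trying k (run tryVertex (setVar vW k s))
      tryVertex-spec k s k<n σ = cost≤ , record
        { loaded = loaded-run tryVertex _ L₀
        ; owned = ownedBy-run tryVertex _ O₀
        ; best = ifPositive-elim IsBest vX attempt skip s₁
            (λ d≢0 → attempted λ w∈ → d≢0 (trans vX≡ (distance-member w∈)))
            (λ d≡0 → best-member w w≡k (λ w∉ → w∉ (member (trans (sym vX≡) d≡0))) best)
        }
        where
        open Trying σ
        IsBest : State → Set ℓ₂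
        IsBest s = Best k (var s vFound) (var s vAnswer) (fvar s fBest)

        attempt : Cmd
        attempt = op (mov vSource vW) ⨾ bfs ⨾ evaluate ⨾ keepBetter

        w : Fin n
        w = fromℕ< k<n
        w≡k : toℕ w ≡ k
        w≡k = Fin.toℕ-fromℕ< k<n

        s₀ s₁ s₂ s₃ s₄ : State
        s₀ = setVar vW k s
        s₁ = run (op (get vX aBest vW) ⨾ op (set vZ 1) ⨾ op (minus vX vX vZ)) s₀
        s₂ = run (op (mov vSource vW)) s₁
        s₃ = run bfs s₂
        s₄ = run evaluate s₃

        L₀ : Loaded s₀
        L₀ = loaded-setVar vW k _ loaded
        O₀ : OwnedBy owner s₀
        O₀ = record { OwnedBy owned }
        L₂ : Loaded s₂
        L₂ = loaded-run (op (get vX aBest vW) ⨾ op (set vZ 1) ⨾ op (minus vX vX vZ) ⨾ op (mov vSource vW)) _ L₀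
        O₂ : OwnedBy owner s₂
        O₂ = ownedBy-run (op (get vX aBest vW) ⨾ op (set vZ 1) ⨾ op (minus vX vX vZ) ⨾ op (mov vSource vW)) _ O₀

        vX≡ : var s₁ vX ≡ dist G w (lookup S (owner w))
        vX≡ = cong (_∸ 1) (trans (cong (arr s aBest) (sym w≡k)) (OwnedBy.best≡ owned w))

        member : dist G w (lookup S (owner w)) ≡ 0 → w ∈ᵛ S
        member d≡0 = subst (_∈ᵛ S) (sym (dist≡0⇒≡ d≡0)) (∈-lookup (owner w) S)

        distance-member : w ∈ᵛ S → dist G w (lookup S (owner w)) ≡ 0
        distance-member w∈ = n≤0⇒n≡0 (≤-trans (proj₁ (owns w) (VecAny.index w∈))
          (≤-reflexive (trans (cong (dist G w) (sym (VecAny.lookup-index w∈))) (dist-refl w))))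

        searched = bfs-spec w s₂ L₂ (sym w≡k)
        evaluated = evaluate-spec w owner owns s₃ (loaded-run bfs _ L₂) (ownedBy-run bfs _ O₂) (proj₂ searched)

        best₄ : Best (suc k) (var s₄ vFound) (var s₄ vAnswer) (fvar s₄ fBest)
        best₄ = subst₂ (λ f a → Best (suc k) f a (fvar s₄ fBest)) (sym (kept vFound _ _)) (sym (kept vAnswer _ _))
          (subst (Best (suc k) (var s vFound) (var s vAnswer))
            (sym (trans (exec-fvar evaluate _ s₃) (exec-fvar bfs _ s₂))) best)
          where
          kept : ∀ v → KeepsVar v evaluate → KeepsVar v bfs → var s₄ v ≡ var s₂ v
          kept v e b = trans (exec-var evaluate e s₃) (exec-var bfs b s₂)

        vW≡ : var s₄ vW ≡ k
        vW≡ = trans (exec-var evaluate _ s₃) (exec-var bfs _ s₂)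

        attempted : w ∉ᵛ S → IsBest (run attempt s₁)
        attempted w∉ = ifPositive-elim IsBest vFound (ifLeqF fBest fMax skip recordBest) recordBest s₄
          (λ f≢0 → ifLeqF-elim IsBest fBest fMax skip recordBest s₄
            (λ x≤y → best-keep w w≡k (proj₁ (proj₂ evaluated)) (proj₂ (proj₂ evaluated)) f≢0 x≤y best₄)
            (λ x≰y → recorded (inj₂ (flip x≰y))))
          (λ f≡0 → recorded (inj₁ f≡0))
          where
          flip : ¬ (fvar s₄ fBest ≤ᶠ fvar s₄ fMax) → fvar s₄ fMax ≤ᶠ fvar s₄ fBest
          flip x≰y with ≤ᶠ-total (fvar s₄ fMax) (fvar s₄ fBest)
          ... | inj₁ y≤x = y≤x
          ... | inj₂ x≤y = contradiction x≤y x≰y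

          recorded : var s₄ vFound ≡ 0 ⊎ fvar s₄ fMax ≤ᶠ fvar s₄ fBest → IsBest (run recordBest s₄)
          recorded f≡0⊎ = subst (λ a → Best k 1 a (fvar s₄ fMax)) (sym vW≡)
            (best-replace w w≡k (proj₁ (proj₂ evaluated)) (proj₂ (proj₂ evaluated)) w∉ f≡0⊎ best₄)

        cost≤ : cost tryVertex s₀ ≤ 304 * degreeSum
        cost≤ = begin
          13 + (2 + (cost bfs s₂ + (cost evaluate s₃ + 14)) + 0)
            ≤⟨ +-monoʳ-≤ 13 (+-monoˡ-≤ 0 (+-monoʳ-≤ 2
                 (+-mono-≤ (proj₁ searched) (+-monoˡ-≤ 14 (proj₁ evaluated))))) ⟩
          13 + (2 + (144 * degreeSum + (131 * degreeSum + 14)) + 0)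
            ≡⟨ arith degreeSum ⟩
          29 + n * 0 + 275 * degreeSum
            -- The void summand `n * 0` fits `linear≤`, which here absorbs the constant alone.
            ≤⟨ +-monoˡ-≤ _ (linear≤ 29 0) ⟩
          29 * degreeSum + 275 * degreeSum
            ≡⟨ *-distribʳ-+ degreeSum 29 275 ⟨
          304 * degreeSum ∎
          where
          open ≤-Reasoning
          arith′ : ∀ e z → 13 + (2 + (144 * e + (131 * e + 14)) + 0) ≡ 29 + z * 0 + 275 * e
          arith′ = solve-∀
          arith : ∀ e → 13 + (2 + (144 * e + (131 * e + 14)) + 0) ≡ 29 + n * 0 + 275 * e
          arith e = arith′ e n

      findBest-spec : ∀ s → Loaded s → OwnedBy owner s → var s vFound ≡ 0 →
        cost findBest s ≤ 312 * (n * degreeSum) ×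
        ∃ λ v → var (run findBest s) vAnswer ≡ toℕ v × IsSolution R I v
      findBest-spec s L O found≡0 = constant≤ 2 310 (≤-trans (proj₁ tried) (loop≤ 304 ≤-refl)) ,
        solution (Trying.best (proj₂ tried))
        where
        s₁ : State
        s₁ = run (op (mov vW vN)) s

        tried : cost (loop vW tryVertex) s₁ ≤ 2 + n * (4 + 304 * degreeSum) × Trying 0 (run (loop vW tryVertex) s₁)
        tried = loop-invariant vW tryVertex Trying (304 * degreeSum) n tryVertex-spec s₁ (n≡ L) record
          { loaded = loaded-run (op (mov vW vN)) _ L
          ; owned = record { OwnedBy O }
          ; best = inj₁ (Level.lift (found≡0 , λ v n≤v → contradiction (Fin.toℕ<n v) (≤⇒≯ n≤v)))
          }

        solution : ∀ {f a x} → Best 0 f a x → ∃ λ v → a ≡ toℕ v × IsSolution R I v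
        -- Ending without a candidate contradicts the instance, which provides one.
        solution (inj₁ (Level.lift (_ , none))) = contradiction (proj₂ candidate) (none (proj₁ candidate) z≤n)
        solution (inj₂ (_ , v , a≡ , v∉ , _ , _ , min)) = v , a≡ , v∉ , λ u → min u z≤n

    -- Reading the adjacency lists

    record Stored (s : State) (v : Fin n) : Set where
      field
        degree≡    : arr s aDeg (toℕ v) ≡ degree v
        -- Later items are written from `vJ` on, so the block of v survives the reading of the
        -- remaining vertices.
        end≤       : arr s aStart (toℕ v) + degree v ≤ var s vJ
        neighbour≡ : ∀ j → arr s aNbr (arr s aStart (toℕ v) + toℕ j) ≡ toℕ (List.lookup (nbrs v) j)

    private
      entry : Fin n → List ℕ
      entry v = length (nbrs v) ∷ List.map toℕ (nbrs v)

      map-toℕ : ∀ {k} (xs : List (Fin k)) → List.map toℕ xs ≡ List.tabulate (toℕ ∘ List.lookup xs)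
      map-toℕ xs = trans (cong (List.map toℕ) (sym (List.tabulate-lookup xs))) (List.map-tabulate (List.lookup xs) toℕ)

    readVertex-spec : ∀ v {rest} s → var s vU ≡ toℕ v → tape s ≡ entry v ++ rest →
      cost readVertex s ≤ 23 + degree v * 16 ×
      tape (run readVertex s) ≡ rest × Stored (run readVertex s) v × var s vJ ≤ var (run readVertex s) vJ ×
      (∀ x → x < toℕ v → arr (run readVertex s) aDeg x ≡ arr s aDeg x) ×
      (∀ x → x < toℕ v → arr (run readVertex s) aStart x ≡ arr s aStart x) ×
      (∀ x → x < var s vJ → arr (run readVertex s) aNbr x ≡ arr s aNbr x)
    readVertex-spec v {rest} s vU≡ t≡
      with readItems-spec (toℕ ∘ List.lookup (nbrs v)) {rest} (run readVertexHead s)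
             (cong (proj₁ ∘ RAM.next R 0) t≡)
             (trans (cong (proj₂ ∘ RAM.next R 0) t≡) (cong (_++ rest) (map-toℕ (nbrs v))))
    ... | cost≤ , tape≡ , vJ≡ , stored , kept =
      ≤-trans (+-monoʳ-≤ 19 (+-monoˡ-≤ 2 cost≤)) (≤-reflexive (cong (19 +_) (+-comm (2 + degree v * 16) 2))) ,
      tape≡ , record
        { degree≡ = trans (deg-at (toℕ v)) (trans (cong (λ x → (arr s aDeg [ x ↦ k ]) (toℕ v)) vU≡)
            (trans (update-same (arr s aDeg) (toℕ v) k) (cong (proj₁ ∘ RAM.next R 0) t≡)))
        ; end≤ = ≤-reflexive (trans (cong (_+ degree v) start≡) (sym vJ≡))
        ; neighbour≡ = λ j → trans (cong (λ x → arr s′ aNbr (x + toℕ j)) start≡) (stored j)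
        } ,
      ≤-trans (m≤m+n _ _) (≤-reflexive (sym vJ≡)) ,
      (λ x x<v → trans (deg-at x) (update-other (arr s aDeg) k (below x<v))) ,
      (λ x x<v → trans (start-at x) (update-other (arr s aStart) (var s vJ) (below x<v))) ,
      kept
      where
      k : ℕ
      k = proj₁ (RAM.next R 0 (tape s))
      s₁ s′ : State
      s₁ = run readVertexHead s
      s′ = run readVertex s

      below : ∀ {x} → x < toℕ v → x ≢ var s vU
      below x<v = <⇒≢ (subst (_ <_) (sym vU≡) x<v)

      deg-at : ∀ x → arr s′ aDeg x ≡ (arr s aDeg [ var s vU ↦ k ]) x
      deg-at x = cong (λ f → f x) (exec-arr (loop vK readItem) _ s₁)
      start-at : ∀ x → arr s′ aStart x ≡ (arr s aStart [ var s vU ↦ var s vJ ]) x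
      start-at x = cong (λ f → f x) (exec-arr (loop vK readItem) _ s₁)

      start≡ : arr s′ aStart (toℕ v) ≡ var s vJ
      start≡ = trans (start-at (toℕ v)) (trans (cong (λ x → (arr s aStart [ x ↦ var s vJ ]) (toℕ v)) vU≡)
        (update-same (arr s aStart) (toℕ v) (var s vJ)))

    -- Generalised for the induction: g enumerates the vertices still to be read, beginning at `vU`,
    -- and the cells of earlier vertices are kept. A vertex costs 27 = 4 + 23, an arc 16.
    readVertices-spec : ∀ {m} (g : Fin m → Fin n) s → (∀ i → toℕ (g i) ≡ var s vU + toℕ i) →
      tape s ≡ List.concatMap entry (List.tabulate g) → let s′ = repeat vC readVertex m s in
      repeatCost vC readVertex m s ≤ 2 + (m * 27 + sum (degree ∘ g) * 16) ×
      (∀ i → Stored s′ (g i)) × var s vJ ≤ var s′ vJ ×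
      (∀ x → x < var s vU → arr s′ aDeg x ≡ arr s aDeg x) ×
      (∀ x → x < var s vU → arr s′ aStart x ≡ arr s aStart x) ×
      (∀ x → x < var s vJ → arr s′ aNbr x ≡ arr s aNbr x)
    readVertices-spec {zero}  g s g≡ t≡ = ≤-refl , (λ ()) , ≤-refl , (λ _ _ → refl) , (λ _ _ → refl) , λ _ _ → refl
    readVertices-spec {suc m} g s g≡ t≡
      with readVertex-spec (g zero) (setVar vC m s) (sym (trans (g≡ zero) (+-identityʳ _))) t≡
    ... | cost₁≤ , tape₁ , stored₁ , J₁ , deg₁ , start₁ , nbr₁
      with readVertices-spec (g ∘ suc) s₁ (λ i → trans (g≡ (suc i))
             (trans (+-suc (var s vU) (toℕ i)) (cong (_+ toℕ i) (sym vU₁)))) tape₁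
      where
      s₁ : State
      s₁ = run readVertex (setVar vC m s)
      vU₁ : var s₁ vU ≡ suc (var s vU)
      vU₁ = cong suc (exec-var (loop vK readItem) _ (run readVertexHead (setVar vC m s)))
    ... | cost₂≤ , stored₂ , J₂ , deg₂ , start₂ , nbr₂ = cost≤ , stored , ≤-trans J₁ J₂ ,
      (λ x x<u → trans (deg₂ x (later x<u)) (deg₁ x (first x<u))) ,
      (λ x x<u → trans (start₂ x (later x<u)) (start₁ x (first x<u))) ,
      λ x x<j → trans (nbr₂ x (≤-trans x<j J₁)) (nbr₁ x x<j)
      where
      s₁ s₂ : State
      s₁ = run readVertex (setVar vC m s)
      s₂ = repeat vC readVertex m s₁

      vU₁ : var s₁ vU ≡ suc (var s vU)
      vU₁ = cong suc (exec-var (loop vK readItem) _ (run readVertexHead (setVar vC m s)))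
      g₀ : toℕ (g zero) ≡ var s vU
      g₀ = trans (g≡ zero) (+-identityʳ _)

      later : ∀ {x} → x < var s vU → x < var s₁ vU
      later x<u = ≤-trans (m<n⇒m<1+n x<u) (≤-reflexive (sym vU₁))
      first : ∀ {x} → x < var s vU → x < toℕ (g zero)
      first x<u = ≤-trans x<u (≤-reflexive (sym g₀))

      here : toℕ (g zero) < var s₁ vU
      here = ≤-reflexive (trans (cong suc g₀) (sym vU₁))

      start≡ : arr s₂ aStart (toℕ (g zero)) ≡ arr s₁ aStart (toℕ (g zero))
      start≡ = start₂ _ here

      stored : ∀ i → Stored s₂ (g i)
      stored (suc i) = stored₂ i
      stored zero    = record
        { degree≡ = trans (deg₂ _ here) (Stored.degree≡ stored₁)
        ; end≤ = ≤-trans (≤-reflexive (cong (_+ degree (g zero)) start≡)) (≤-trans (Stored.end≤ stored₁) J₂)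
        ; neighbour≡ = λ j → trans (cong (λ x → arr s₂ aNbr (x + toℕ j)) start≡)
            (trans (nbr₂ _ (≤-trans (+-monoʳ-< (arr s₁ aStart (toℕ (g zero))) (Fin.toℕ<n j)) (Stored.end≤ stored₁)))
              (Stored.neighbour≡ stored₁ j))
        }

      cost≤ : repeatCost vC readVertex (suc m) s ≤ 2 + (suc m * 27 + sum (degree ∘ g) * 16)
      cost≤ = ≤-trans (+-mono-≤ (+-monoʳ-≤ 4 cost₁≤) cost₂≤)
        (≤-reflexive (arith (degree (g zero)) m (sum (degree ∘ g ∘ suc))))
        where
        arith : ∀ d m z → 4 + (23 + d * 16) + (2 + (m * 27 + z * 16)) ≡ 2 + (suc m * 27 + (d + z) * 16)
        arith = solve-∀

    tapeᴺ : List ℕ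
    tapeᴺ = n ∷ suc q ∷ List.map toℕ (Vec.toList S) ++ List.concatMap entry (List.allFin n)

    begin₀ : State
    begin₀ = initial tapeᴺ (List.tabulate π)

    map-toℕ-toList : ∀ {k} (xs : Vec (Fin n) k) → List.map toℕ (Vec.toList xs) ≡ List.tabulate (toℕ ∘ lookup xs)
    map-toℕ-toList []       = refl
    map-toℕ-toList (x ∷ xs) = cong (toℕ x ∷_) (map-toℕ-toList xs)

    readInput-spec : cost readInput begin₀ ≤ 90 * degreeSum × Loaded (run readInput begin₀)
    readInput-spec = cost≤ , record
      { n≡         = trans (exec-var (after-members ⨾ after-vertices) _ s₂) n₂
      ; p≡         = trans (exec-var (after-members ⨾ after-vertices) _ s₂) (exec-var (loop vK readItem) _ s₁)
      ; members    = λ i → trans (cong (λ f → f (toℕ i)) (exec-arr after-vertices _ s₄))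
          (trans (nbrs-kept (toℕ i) (subst (toℕ i <_) (sym vJ₂) (Fin.toℕ<n i))) (members₂ i))
      ; degrees    = λ v → trans (cong (λ f → f (toℕ v)) (exec-arr after-vertices _ s₄)) (Stored.degree≡ (vertices v))
      ; neighbours = λ v j → trans (cong₂ (λ f g → f (g (toℕ v) + toℕ j))
            (exec-arr after-vertices _ s₄) (exec-arr after-vertices _ s₄)) (Stored.neighbour≡ (vertices v) j)
      ; costs      = proj₂ costs₅
      }
      where
      after-members after-vertices : Cmd
      after-members  = op (mov vC vN) ⨾ loop vC readVertex
      after-vertices = (op (mov vC vN) ⨾ op (set vU 0)) ⨾ loop vC readCost

      s₁ s₂ s₃ s₄ s₅ : State
      s₁ = run (op (readN vN) ⨾ op (readN vP) ⨾ op (mov vK vP)) begin₀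
      s₂ = run (loop vK readItem) s₁
      s₃ = run (op (mov vC vN)) s₂
      s₄ = run (loop vC readVertex) s₃
      s₅ = run (op (mov vC vN) ⨾ op (set vU 0)) s₄

      spec₂ = readItems-spec (toℕ ∘ lookup S) {List.concatMap entry (List.allFin n)} s₁ refl
        (cong (_++ List.concatMap entry (List.allFin n)) (map-toℕ-toList S))

      vJ₂ : var s₂ vJ ≡ suc q
      vJ₂ = proj₁ (proj₂ (proj₂ spec₂))
      members₂ : ∀ i → arr s₂ aNbr (toℕ i) ≡ toℕ (lookup S i)
      members₂ = proj₁ (proj₂ (proj₂ (proj₂ spec₂)))
      n₂ : var s₂ vN ≡ n
      n₂ = exec-var (loop vK readItem) _ s₁

      spec₄ = readVertices-spec (λ v → v) s₃
        (λ i → cong (_+ toℕ i) (sym (exec-var (loop vK readItem) _ s₁))) (proj₁ (proj₂ spec₂))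

      vertices : ∀ v → Stored s₄ v
      -- The loop makes as many rounds as its variable says, which equals n only propositionally;
      -- the specification for n rounds is transported.
      vertices = subst (λ k → ∀ v → Stored (repeat vC readVertex k s₃) v) (sym n₂) (proj₁ (proj₂ spec₄))
      nbrs-kept : ∀ x → x < var s₂ vJ → arr s₄ aNbr x ≡ arr s₂ aNbr x
      nbrs-kept = subst (λ k → ∀ x → x < var s₂ vJ → arr (repeat vC readVertex k s₃) aNbr x ≡ arr s₂ aNbr x) (sym n₂)
        (proj₂ (proj₂ (proj₂ (proj₂ (proj₂ spec₄)))))

      costs₅ : cost (loop vC readCost) s₅ ≤ 2 + n * 16 ×
        (∀ v → farr (run (loop vC readCost) s₅) aCost (toℕ v) ≡ π v)
      costs₅ = readCosts-spec π s₅ (trans (exec-var (loop vC readVertex) _ s₃) n₂)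
        (exec-tapeᶠ ((op (readN vN) ⨾ op (readN vP) ⨾ op (mov vK vP)) ⨾ loop vK readItem ⨾ after-members) _ begin₀)

      cost≤ : cost readInput begin₀ ≤ 90 * degreeSum
      cost≤ = begin
        4 + (cost (loop vK readItem) s₁ + (2 + (cost (loop vC readVertex) s₃ + (3 + cost (loop vC readCost) s₅))))
          ≤⟨ +-monoʳ-≤ 4 (+-mono-≤ (≤-trans (proj₁ spec₂) (+-monoʳ-≤ 2 (*-monoˡ-≤ 16 p≤n)))
               (+-monoʳ-≤ 2 (+-mono-≤ vertices≤ (+-monoʳ-≤ 3 (proj₁ costs₅))))) ⟩
        4 + (2 + n * 16 + (2 + (2 + (n * 27 + degreeSum * 16) + (3 + (2 + n * 16)))))
          ≡⟨ arith n degreeSum ⟩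
        15 + n * 59 + 16 * degreeSum
          ≤⟨ +-monoˡ-≤ _ (linear≤ 15 59) ⟩
        74 * degreeSum + 16 * degreeSum
          ≡⟨ *-distribʳ-+ degreeSum 74 16 ⟨
        90 * degreeSum ∎
        where
        open ≤-Reasoning
        vertices≤ : cost (loop vC readVertex) s₃ ≤ 2 + (n * 27 + degreeSum * 16)
        vertices≤ = subst (λ k → repeatCost vC readVertex k s₃ ≤ 2 + (n * 27 + degreeSum * 16)) (sym n₂) (proj₁ spec₄)
        arith : ∀ n e → 4 + (2 + n * 16 + (2 + (2 + (n * 27 + e * 16) + (3 + (2 + n * 16))))) ≡ 15 + n * 59 + 16 * e
        arith = solve-∀

    -- Total running time

    solver-spec : cost solver begin₀ ≤ 1260 * (n * m) ×
      ∃ λ v → var (run solver begin₀) vAnswer ≡ toℕ v × IsSolution R I v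
    solver-spec = cost≤ , proj₂ found
      where
      s₁ s₂ : State
      s₁ = run readInput begin₀
      s₂ = run chooseOwners s₁

      L₁ : Loaded s₁
      L₁ = proj₂ readInput-spec
      -- Reading leaves `aBest` in its initial state, all zero, so every vertex starts without an
      -- owner.
      chosen = chooseOwners-spec s₁ L₁ λ i → cong (λ f → f i) (exec-arr readInput _ begin₀)
      found = findBest-spec (proj₁ (proj₂ chosen)) (proj₁ (proj₂ (proj₂ chosen))) s₂
        (loaded-run chooseOwners _ L₁) (proj₂ (proj₂ (proj₂ chosen)))
        (trans (exec-var chooseOwners _ s₁) (exec-var readInput _ begin₀))

      cost≤ : cost solver begin₀ ≤ 1260 * (n * m)
      cost≤ = begin
        cost readInput begin₀ + (cost chooseOwners s₁ + cost findBest s₂)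
          -- Reading happens once; its bound is weakened by a factor n to match the other two.
          ≤⟨ +-mono-≤ (≤-trans (proj₁ readInput-spec) (*-monoʳ-≤ 90 (m≤n*m degreeSum n {{>-nonZero 1≤n}})))
                      (+-mono-≤ (proj₁ chosen) (proj₁ found)) ⟩
        90 * (n * degreeSum) + (228 * (n * degreeSum) + 312 * (n * degreeSum))
          ≡⟨ collect (n * degreeSum) ⟩
        630 * (n * degreeSum)
          ≤⟨ *-monoʳ-≤ 630 (*-monoʳ-≤ n degreeSum≤2*size) ⟩
        630 * (n * (2 * m))
          ≡⟨ double n m ⟩
        1260 * (n * m) ∎
        where
        open ≤-Reasoning
        collect : ∀ x → 90 * x + (228 * x + 312 * x) ≡ 630 * x
        collect = solve-∀
        double : ∀ x y → 630 * (x * (2 * y)) ≡ 1260 * (x * y)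
        double = solve-∀

theorem2p5 : ∀ {c ℓ₁ ℓ₂} (R : OrderedField c ℓ₁ ℓ₂) → let open RAM R in
    Σ Program λ P → Σ ℕ λ C →
    (I : Instance R) (A : AdjacencyLists (Instance.graph I)) → let open Instance I in
    ∃ λ t → ∃ λ s → ∃ λ v →
    (P ⊢ input R I A ⇓[ t ] s) × (t ≤ C * (n * m)) × (output s ≡ toℕ v) × IsSolution R I v
theorem2p5 R = code 0 solver , 1260 , λ I A →
  -- The underscore is the well-formedness of `solver`, a product of unit types after computation.
  compiled R solver (begin₀ R I A) _ refl refl (solver-spec R I A)
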